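{- Let $q_1,q_2$ be prime powers and $\nu_1,\nu_2\geq 1$ integers. Then the graphs $Spi(2\nu_1,q_1)$ and $Spi(2\nu_2,q_2)$ are isomorphic if and only if $\nu_1=\nu_2$ and $q_1=q_2$.
   Context: For a prime power $q$ and $\nu\ge1$, let $\mathbb{F}_q$ be the field with $q$ elements, $\mathbb{F}_q^{(2\nu)}$ the space of row vectors of length $2\nu$, and $K_{2\nu}=\begin{pmatrix}0 & I^{(\nu)}\\ -I^{(\nu)} & 0\end{pmatrix}$. A subspace of dimension $m$ is identified with any $m\times 2\nu$ matrix whose rows form a basis of it. The symplectic inner product graph $Spi(2\nu,q)$ has as vertex set all subspaces of $\mathbb{F}_q^{(2\nu)}$ other than $0$ and $\mathbb{F}_q^{(2\nu)}$, and vertices $A,B$ (not necessarily distinct) are adjacent iff $AK_{2\nu}{}^tB=0$, i.e. $\alpha K_{2\nu}{}^t\beta=0$ for all $\alpha\in A,\beta\in B$. -}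

module Defs where

open import Data.Nat using (ℕ; zero; suc; _+_; _^_)
open import Data.Nat.Primality using (Prime)
open import Data.Fin using (Fin; zero; suc; _↑ˡ_; _↑ʳ_)
import Data.Vec
open import Data.Vec using (Vec; lookup; replicate)
open import Data.Bool using (Bool; true; false)
open import Data.Product using (Σ; ∃; _×_; _,_)
open import Relation.Binary.PropositionalEquality using (_≡_)
open import Relation.Nullary using (¬_)
open import Function.Bundles using (_↔_)
open import Algebra.Core using (Op₁; Op₂)
open import Algebra.Structures using (IsCommutativeRing)

IsPrimePower : ℕ → Set
IsPrimePower q = Σ ℕ λ p → Σ ℕ λ k → Prime p × q ≡ p ^ suc k

record FiniteField (q : ℕ) : Set₁ where
  infixl 6 _+F_
  infixl 7 _*F_
  field
    Carrier   : Set
    _+F_ _*F_ : Op₂ Carrier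
    -F_       : Op₁ Carrier
    0F 1F     : Carrier
    isCommutativeRing : IsCommutativeRing _≡_ _+F_ _*F_ -F_ 0F 1F
    0≢1       : ¬ (0F ≡ 1F)
    inverse   : ∀ x → ¬ (x ≡ 0F) → Σ Carrier λ y → x *F y ≡ 1F
    enumeration : Fin q ↔ Carrier

-- Graphs with a setoid of vertices (vertices = subspaces, compared extensionally)
record Graph : Set₁ where
  field
    Vertex : Set
    _≈_    : Vertex → Vertex → Set
    Adj    : Vertex → Vertex → Set

record _≅G_ (G H : Graph) : Set where
  private
    module G = Graph G
    module H = Graph H
  field
    to       : G.Vertex → H.Vertex
    from     : H.Vertex → G.Vertex
    to-cong   : ∀ {x y} → x G.≈ y → to x H.≈ to y
    from-cong : ∀ {x y} → x H.≈ y → from x G.≈ from y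
    from∘to  : ∀ x → from (to x) G.≈ x
    to∘from  : ∀ y → to (from y) H.≈ y
    adj-to   : ∀ x y → G.Adj x y → H.Adj (to x) (to y)
    adj-from : ∀ x y → H.Adj (to x) (to y) → G.Adj x y

module Symplectic {q : ℕ} (F : FiniteField q) (ν : ℕ) where
  open FiniteField F

  Row : Set
  Row = Vec Carrier (ν + ν)

  ∑ : (n : ℕ) → (Fin n → Carrier) → Carrier
  ∑ zero    f = 0F
  ∑ (suc n) f = f zero +F ∑ n (λ i → f (suc i))

  zeroRow : Row
  zeroRow = replicate (ν + ν) 0F

  _+R_ : Row → Row → Row
  _+R_ = Data.Vec.zipWith _+F_

  _·R_ : Carrier → Row → Row
  c ·R v = Data.Vec.map (c *F_) v

  -- α K_{2ν} ᵗβ = Σ_i (α_i β_{ν+i} − α_{ν+i} β_i)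
  ⟪_,_⟫ : Row → Row → Carrier
  ⟪ α , β ⟫ = ∑ ν λ i →
      (lookup α (i ↑ˡ ν) *F lookup β (ν ↑ʳ i))
        +F -F (lookup α (ν ↑ʳ i) *F lookup β (i ↑ˡ ν))

  record Subspace : Set where
    field
      mem      : Row → Bool
      mem-0    : mem zeroRow ≡ true
      mem-+    : ∀ u v → mem u ≡ true → mem v ≡ true → mem (u +R v) ≡ true
      mem-·    : ∀ c v → mem v ≡ true → mem (c ·R v) ≡ true

  record ProperSubspace : Set where
    field
      subspace : Subspace
      nonzero  : ∃ λ v → ¬ (v ≡ zeroRow) × Subspace.mem subspace v ≡ true
      nonfull  : ∃ λ v → Subspace.mem subspace v ≡ false

  _≈S_ : ProperSubspace → ProperSubspace → Set
  A ≈S B = ∀ v → Subspace.mem (ProperSubspace.subspace A) v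
               ≡ Subspace.mem (ProperSubspace.subspace B) v

  -- A ~ B  iff  A K ᵗB = 0
  Adjacent : ProperSubspace → ProperSubspace → Set
  Adjacent A B = ∀ α β → Subspace.mem (ProperSubspace.subspace A) α ≡ true
                       → Subspace.mem (ProperSubspace.subspace B) β ≡ true
                       → ⟪ α , β ⟫ ≡ 0F

  Spi : Graph
  Spi = record { Vertex = ProperSubspace ; _≈_ = _≈S_ ; Adj = Adjacent }

Spi : {q : ℕ} → FiniteField q → ℕ → Graph
Spi F ν = Symplectic.Spi F ν

{-# OPTIONS --safe #-}

-- A subspace equals its double perp, so B ⊑ A iff every neighbour of A is a neighbour of B, and an
-- isomorphism of the graphs preserves inclusion. A strict chain of k proper subspaces embeds
-- K ^ (k + 1) in the space, so the longest chains have 2ν − 1 members, which determines ν. Nonzero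
-- subspaces being sent to nonzero subspaces, the points of one projective space inject into those of
-- the other, and the number 1 + q + … + q ^ (2ν − 1) of points determines q.
--
-- Conversely two fields with q elements are isomorphic. Modulo x ^ q = x a polynomial has degree < q in
-- each variable, and such a polynomial vanishing on a field with q elements has all coefficients zero in
-- that field; hence the fields satisfy the same polynomial identities with natural coefficients.
-- With one variable per element of F₁, the product over the entries of the addition and multiplication
-- tables of F₁ of the polynomials 1 − f ^ (q − 1), where f = 0 is the entry, takes the value 1 at
-- the elements of F₁. So it is nonzero at some point of F₂, and that point is a homomorphism F₁ → F₂.

module Submission where

open import Defs
open import Level using (0ℓ)
open import Data.Nat as ℕ using (ℕ; zero; suc; pred; _≤_; _<_; _≥_; z≤n; s≤s; 2+)
import Data.Nat.Properties as ℕ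
open import Data.Nat.Divisibility using (_∣_; divides; _∣?_)
open import Data.Nat.Primality using (Prime; prime⇒irreducible)
open import Data.Nat.GCD using (module Bézout)
open import Data.Nat.Coprimality using (Coprime; coprime-Bézout)
open import Data.Fin as Fin using (Fin; zero; suc)
import Data.Fin.Properties as Fin
open import Data.Fin.Permutation using (Permutation′)
open import Data.Vec as Vec using (Vec; []; _∷_; lookup; replicate; zipWith; map; tabulate)
import Data.Vec.Functional as Vector
import Data.Vec.Properties as Vec
open import Data.Product using (∃; ∃₂; _×_; _,_; proj₁; proj₂; uncurry)
open import Data.Sum using (_⊎_; inj₁; inj₂)
open import Data.Bool as Bool using (Bool; true; false)
open import Data.Empty using (⊥)
open import Relation.Nullary using (¬_; Dec; yes; no; contradiction)
open import Relation.Nullary.Decidable using (via-injection; map′; does; ¬?; _×-dec_; _→-dec_; decidable-stable; dec-true; dec-false)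
open import Relation.Unary using (Decidable)
open import Relation.Binary.Definitions using (DecidableEquality)
open import Relation.Binary.PropositionalEquality
open import Function using (_∘_; id)
open import Function.Bundles using (_⇔_; _↔_; mk↔ₛ′; mk⇔; module Inverse; module Injection)
open import Function.Properties.Inverse using (↔⇒↣; ↔-sym; ↔-trans)
open import Data.Product.Function.NonDependent.Propositional using (_×-↔_)
open import Data.Sum.Function.Propositional using (_⊎-↔_)
open import Algebra.Bundles using (CommutativeRing)
import Algebra.Properties.CommutativeMonoid.Sum as MonoidSum
import Algebra.Properties.Ring as RingProperties
import Algebra.Properties.Semiring.Mult as SemiringMult
import Algebra.Properties.Semiring.Exp as SemiringExp
import Algebra.Solver.Ring.NaturalCoefficients.Default as SemiringSolver

open ≡-Reasoning


-- Arithmetic of a field with q elements: Fermat's theorem and the characteristic.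

module FieldTheory {q : ℕ} (F : FiniteField q) where
  open FiniteField F public

  commutativeRing : CommutativeRing 0ℓ 0ℓ
  commutativeRing = record { isCommutativeRing = isCommutativeRing }

  module R = CommutativeRing commutativeRing
  module RP = RingProperties R.ring
  module E = Inverse enumeration
  module Solver = SemiringSolver R.commutativeSemiring
  open SemiringMult R.semiring public using (×1-homo-*; ×-homo-+) renaming (_×_ to _·_)
  open SemiringExp R.semiring public using (_^_)

  private
    module Add  = MonoidSum R.+-commutativeMonoid
    module Mul  = MonoidSum R.*-commutativeMonoid

  infix 4 _≟_
  _≟_ : DecidableEquality Carrier
  _≟_ = via-injection (↔⇒↣ (↔-sym enumeration)) Fin._≟_

  to-from : ∀ x → E.to (E.from x) ≡ x
  to-from = E.strictlyInverseˡ

  from-to : ∀ i → E.from (E.to i) ≡ i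
  from-to = E.strictlyInverseʳ

  to-injective : ∀ {i j} → E.to i ≡ E.to j → i ≡ j
  to-injective eq = trans (sym (from-to _)) (trans (cong E.from eq) (from-to _))

  search : {P : Carrier → Set} → Decidable P → Dec (∃ P)
  search {P} P? = map′ (λ (i , p) → E.to i , p)
                       (λ (x , p) → E.from x , subst P (sym (to-from x)) p)
                       (Fin.any? (P? ∘ E.to))

  searchVec : ∀ n {P : Vec Carrier n → Set} → Decidable P → Dec (∃ P)
  searchVec zero    P? = map′ ([] ,_) (λ { ([] , p) → p }) (P? [])
  searchVec (suc n) P? = map′ (λ (x , xs , p) → x ∷ xs , p) (λ { (x ∷ xs , p) → x , xs , p })
                              (search λ x → searchVec n (P? ∘ (x ∷_)))

  size≥2 : ∃ λ r → q ≡ 2+ r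
  size≥2 = helper q enumeration
    where
    helper : ∀ q → Fin q ↔ Carrier → ∃ λ r → q ≡ 2+ r
    helper 0      e = contradiction (Inverse.from e 0F) λ ()
    helper 1      e = contradiction (trans (sym (Inverse.strictlyInverseˡ e 0F))
                        (trans (cong (Inverse.to e) (unique _ _)) (Inverse.strictlyInverseˡ e 1F))) 0≢1
      where
      unique : (i j : Fin 1) → i ≡ j
      unique zero zero = refl
    helper (2+ r) e = r , refl

  x*y≡0⇒y≡0 : ∀ {x y} → x ≢ 0F → x *F y ≡ 0F → y ≡ 0F
  x*y≡0⇒y≡0 {x} {y} x≢0 eq with z , xz≡1 ← inverse x x≢0 = begin
    y              ≡⟨ R.*-identityˡ y ⟨
    1F *F y        ≡⟨ cong (_*F y) xz≡1 ⟨
    x *F z *F y    ≡⟨ cong (_*F y) (R.*-comm x z) ⟩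
    z *F x *F y    ≡⟨ R.*-assoc z x y ⟩
    z *F (x *F y)  ≡⟨ cong (z *F_) eq ⟩
    z *F 0F        ≡⟨ R.zeroʳ z ⟩
    0F             ∎

  *-nonzero : ∀ {x y} → x ≢ 0F → y ≢ 0F → x *F y ≢ 0F
  *-nonzero x≢0 y≢0 eq = y≢0 (x*y≡0⇒y≡0 x≢0 eq)

  x-y≡0⇒x≡y : ∀ {x y} → x R.- y ≡ 0F → x ≡ y
  x-y≡0⇒x≡y = RP.x∙y⁻¹≈ε⇒x≈y _ _

  -- Translation by 1 permutes the field, so it leaves the sum of all elements unchanged while
  -- raising it by q · 1.
  size·1≡0 : q · 1F ≡ 0F
  size·1≡0 = RP.+-identityʳ-unique _ _ (begin
    Add.sum E.to R.+ q · 1F                               ≡⟨ cong (Add.sum E.to R.+_) (Add.sum-replicate q) ⟨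
    Add.sum E.to R.+ Add.sum (Vector.replicate q 1F)      ≡⟨ Add.∑-distrib-+ E.to (Vector.replicate q 1F) ⟨
    Add.sum (λ i → E.to i R.+ 1F)                         ≡⟨ Add.sum-cong-≗ (λ i → sym (to-from (E.to i R.+ 1F))) ⟩
    Add.sum (λ i → E.to (E.from (E.to i R.+ 1F)))         ≡⟨ Add.sum-permute E.to shift ⟨
    Add.sum E.to                                          ∎)
    where
    shift : Permutation′ q
    shift = mk↔ₛ′ (λ i → E.from (E.to i R.+ 1F)) (λ i → E.from (E.to i R.- 1F))
      (λ i → trans (cong (λ z → E.from (z R.+ 1F)) (to-from _)) (trans (cong E.from (RP.//-rightDividesˡ 1F (E.to i))) (from-to i)))
      (λ i → trans (cong (λ z → E.from (z R.- 1F)) (to-from _)) (trans (cong E.from (RP.//-rightDividesʳ 1F (E.to i))) (from-to i)))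

  private
    prod-nonzero : ∀ {n} (f : Fin n → Carrier) → (∀ i → f i ≢ 0F) → Mul.sum f ≢ 0F
    prod-nonzero {zero}  f f≢0 = 0≢1 ∘ sym
    prod-nonzero {suc n} f f≢0 = *-nonzero (f≢0 zero) (prod-nonzero (f ∘ suc) (f≢0 ∘ suc))

  module _ {x : Carrier} (x≢0 : x ≢ 0F) where
    private
      x⁻¹ : Carrier
      x⁻¹ = proj₁ (inverse x x≢0)

      xx⁻¹y≡y : ∀ y → x *F (x⁻¹ *F y) ≡ y
      xx⁻¹y≡y y = trans (sym (R.*-assoc x x⁻¹ y)) (trans (cong (_*F y) (proj₂ (inverse x x≢0))) (R.*-identityˡ y))

      x⁻¹xy≡y : ∀ y → x⁻¹ *F (x *F y) ≡ y
      x⁻¹xy≡y y = trans (sym (R.*-assoc x⁻¹ x y)) (trans (cong (_*F y) (trans (R.*-comm x⁻¹ x) (proj₂ (inverse x x≢0)))) (R.*-identityˡ y))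

      -- The product of the nonzero elements is taken over the whole field, with 0 replaced by 1.
      g h : Carrier → Carrier
      g y with y ≟ 0F
      ... | yes _ = 1F
      ... | no  _ = y
      h y with y ≟ 0F
      ... | yes _ = 1F
      ... | no  _ = x

      g-nonzero : ∀ y → g y ≢ 0F
      g-nonzero y with y ≟ 0F
      ... | yes _  = 0≢1 ∘ sym
      ... | no y≢0 = y≢0

      h-zero : h 0F ≡ 1F
      h-zero with 0F ≟ 0F
      ... | yes _  = refl
      ... | no 0≢0 = contradiction refl 0≢0

      h-nonzero : ∀ {y} → y ≢ 0F → h y ≡ x
      h-nonzero {y} y≢0 with y ≟ 0F
      ... | yes y≡0 = contradiction y≡0 y≢0
      ... | no _    = refl

      g-scale : ∀ y → g (x *F y) ≡ h y *F g y
      g-scale y with x *F y ≟ 0F | y ≟ 0F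
      ... | yes _    | yes _   = sym (R.*-identityˡ 1F)
      ... | yes xy≡0 | no y≢0  = contradiction xy≡0 (*-nonzero x≢0 y≢0)
      ... | no xy≢0  | yes y≡0 = contradiction (trans (cong (x *F_) y≡0) (R.zeroʳ x)) xy≢0
      ... | no _     | no _    = refl

      scale : Permutation′ q
      scale = mk↔ₛ′ (λ i → E.from (x *F E.to i)) (λ i → E.from (x⁻¹ *F E.to i))
        (λ i → trans (cong (λ z → E.from (x *F z)) (to-from _)) (trans (cong E.from (xx⁻¹y≡y _)) (from-to i)))
        (λ i → trans (cong (λ z → E.from (x⁻¹ *F z)) (to-from _)) (trans (cong E.from (x⁻¹xy≡y _)) (from-to i)))

      -- Multiplication by `x` permutes the field and, by `g-scale`, turns the product `G` of the
      -- nonzero elements into `H *F G`; the nonzero `G` cancels.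
      prod-h≡1 : Mul.sum (h ∘ E.to) ≡ 1F
      prod-h≡1 = x-y≡0⇒x≡y (x*y≡0⇒y≡0 (prod-nonzero (g ∘ E.to) (g-nonzero ∘ E.to)) (begin
        G *F (H R.- 1F)              ≡⟨ RP.x[y-z]≈xy-xz G H 1F ⟩
        G *F H R.- G *F 1F           ≡⟨ cong₂ R._-_ (R.*-comm G H) (R.*-identityʳ G) ⟩
        H *F G R.- G                 ≡⟨ cong (R._- G) H*G≡G ⟩
        G R.- G                      ≡⟨ R.-‿inverseʳ G ⟩
        0F                           ∎))
        where
        G = Mul.sum (g ∘ E.to)
        H = Mul.sum (h ∘ E.to)
        H*G≡G : H *F G ≡ G
        H*G≡G = begin
          H *F G                                             ≡⟨ Mul.∑-distrib-+ (h ∘ E.to) (g ∘ E.to) ⟨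
          Mul.sum (λ i → h (E.to i) *F g (E.to i))           ≡⟨ Mul.sum-cong-≗ (λ i → sym (g-scale (E.to i))) ⟩
          Mul.sum (λ i → g (x *F E.to i))                    ≡⟨ Mul.sum-cong-≗ (λ i → cong g (sym (to-from (x *F E.to i)))) ⟩
          Mul.sum (λ i → g (E.to (E.from (x *F E.to i))))    ≡⟨ Mul.sum-permute (g ∘ E.to) scale ⟨
          G                                                  ∎

      -- The factor at 0 is 1 and the other `m` factors are `x`. The enumeration is a variable so
      -- that the size of the field can be written as a successor.
      prod-h≡x^ : ∀ {m} (e : Fin (suc m) ↔ Carrier) → Mul.sum (h ∘ Inverse.to e) ≡ x ^ m
      prod-h≡x^ {m} e = begin
        Mul.sum (h ∘ to)                                    ≡⟨ Mul.sum-remove {i = i₀} (h ∘ to) ⟩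
        h (to i₀) *F Mul.sum (Vector.removeAt (h ∘ to) i₀)  ≡⟨ cong₂ _*F_ (trans (cong h to-i₀) h-zero) (Mul.sum-cong-≗ others) ⟩
        1F *F Mul.sum (Vector.replicate m x)                ≡⟨ R.*-identityˡ _ ⟩
        Mul.sum (Vector.replicate m x)                      ≡⟨ Mul.sum-replicate m ⟩
        x ^ m                                               ∎
        where
        open Inverse e using (to; from; strictlyInverseˡ; strictlyInverseʳ)
        i₀ = from 0F
        to-i₀ : to i₀ ≡ 0F
        to-i₀ = strictlyInverseˡ 0F
        others : ∀ j → h (to (Fin.punchIn i₀ j)) ≡ x
        others j = h-nonzero λ eq →
          Fin.punchInᵢ≢i i₀ j (trans (sym (strictlyInverseʳ _)) (cong from eq))

    fermat : x ^ pred q ≡ 1F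
    fermat = helper q enumeration prod-h≡1
      where
      helper : ∀ q (e : Fin q ↔ Carrier) → Mul.sum (h ∘ Inverse.to e) ≡ 1F → x ^ pred q ≡ 1F
      helper zero    e _  = refl
      helper (suc m) e eq = trans (sym (prod-h≡x^ e)) eq

  module _ {p k : ℕ} (p-prime : Prime p) (q≡p^k : q ≡ p ℕ.^ suc k) where

    -- (p ^ k) · 1 is a product of k copies of p · 1, and the field has no zero divisors; at k = 0
    -- the product would be 1.
    prime·1≡0 : p · 1F ≡ 0F
    prime·1≡0 = root (suc k) (trans (cong (_· 1F) (sym q≡p^k)) size·1≡0)
      where
      root : ∀ k → (p ℕ.^ k) · 1F ≡ 0F → p · 1F ≡ 0F
      root zero    eq = contradiction (trans (sym eq) (R.+-identityʳ 1F)) 0≢1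
      root (suc k) eq with p · 1F ≟ 0F
      ... | yes p·1≡0 = p·1≡0
      ... | no  p·1≢0 = root k (x*y≡0⇒y≡0 p·1≢0 (trans (sym (×1-homo-* p (p ℕ.^ k))) eq))

    ∣⇒·1≡0 : ∀ {c} → p ∣ c → c · 1F ≡ 0F
    ∣⇒·1≡0 (divides d refl) = trans (×1-homo-* d p) (trans (cong (d · 1F *F_) prime·1≡0) (R.zeroʳ _))

    -- If p does not divide c, the two are coprime, and Bézout's identity makes 1 the difference of
    -- two multiples that vanish in the field.
    ·1≡0⇒∣ : ∀ {c} → c · 1F ≡ 0F → p ∣ c
    ·1≡0⇒∣ {c} c·1≡0 with p ∣? c
    ... | yes p∣c = p∣c
    ... | no p∤c = contradiction (bezout (coprime-Bézout coprime)) 0≢1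
      where
      coprime : Coprime p c
      coprime (d∣p , d∣c) with prime⇒irreducible p-prime d∣p
      ... | inj₁ d≡1  = d≡1
      ... | inj₂ refl = contradiction d∣c p∤c

      multiple : ∀ y n → n · 1F ≡ 0F → (y ℕ.* n) · 1F ≡ 0F
      multiple y n eq = trans (×1-homo-* y n) (trans (cong (y · 1F *F_) eq) (R.zeroʳ _))

      absurd : ∀ {m n} → 1 ℕ.+ m ≡ n → m · 1F ≡ 0F → n · 1F ≡ 0F → 0F ≡ 1F
      absurd refl m≡0 n≡0 = trans (sym n≡0) (trans (cong (1F R.+_) m≡0) (R.+-identityʳ 1F))

      bezout : Bézout.Identity 1 p c → 0F ≡ 1F
      bezout (Bézout.+- x y eq) = absurd eq (multiple y c c·1≡0) (multiple x p prime·1≡0)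
      bezout (Bézout.-+ x y eq) = absurd eq (multiple x p prime·1≡0) (multiple y c c·1≡0)

-- Expressions in n variables and their normal forms modulo x ^ q ≡ x

data Expr (n : ℕ) : Set where
  var     : Fin n → Expr n
  con     : ℕ → Expr n
  _⊕_ _⊗_ : Expr n → Expr n → Expr n

infixl 6 _⊕_
infixl 7 _⊗_

power : ∀ {n} → Expr n → ℕ → Expr n
power e zero    = con 1
power e (suc k) = e ⊗ power e k

prodE : ∀ {n m} → (Fin m → Expr n) → Expr n
prodE {m = zero}  f = con 1
prodE {m = suc m} f = f zero ⊗ prodE (f ∘ suc)

module Reduced (r : ℕ) where

  -- Polynomials over ℕ in n variables, of degree < q = 2+ r in each of them.
  Red : ℕ → Set
  Red zero    = ℕ
  Red (suc n) = Vec (Red n) (2+ r)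

  zeroR : ∀ n → Red n
  zeroR zero    = 0
  zeroR (suc n) = replicate (2+ r) (zeroR n)

  conR : ∀ n → ℕ → Red n
  conR zero    c = c
  conR (suc n) c = conR n c ∷ replicate (suc r) (zeroR n)

  varR : ∀ {n} → Fin n → Red n
  -- The coefficients 0, 1, 0, ... of the variable take up at least two places, which `2+ r`
  -- provides.
  varR {suc n} zero    = zeroR n ∷ conR n 1 ∷ replicate r (zeroR n)
  varR {suc n} (suc i) = varR i ∷ replicate (suc r) (zeroR n)

  addR : ∀ n → Red n → Red n → Red n
  addR zero    = ℕ._+_
  addR (suc n) = zipWith (addR n)

  unsnoc : ∀ {A : Set} {m} → Vec A (suc m) → Vec A m × A
  unsnoc {m = zero}  (a ∷ []) = [] , a
  unsnoc {m = suc m} (a ∷ as) = let bs , b = unsnoc as in a ∷ bs , b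

  addHead : ∀ n {m} → Red n → Vec (Red n) (suc m) → Vec (Red n) (suc m)
  addHead n c (a ∷ as) = addR n a c ∷ as

  -- Multiplication by the first variable X shifts the coefficients up. The top one would reach
  -- degree q, and X ^ q = X sends it to degree 1, not to degree 0: it is added just behind the new
  -- constant term.
  mulX : ∀ n → Red (suc n) → Red (suc n)
  mulX n as = let bs , b = unsnoc as in zeroR n ∷ addHead n b bs

  -- Horner's scheme on the first factor, so that degrees in the first variable grow, and are
  -- reduced, only through `mulX`.
  mulR : ∀ n → Red n → Red n → Red n
  mulR zero    a  b = a ℕ.* b
  mulR (suc n) as b = Vec.foldr′ (λ a c → addR (suc n) (map (mulR n a) b) (mulX n c)) (zeroR (suc n)) as

  normalise : ∀ {n} → Expr n → Red n
  normalise (var i)  = varR i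
  normalise (con c)  = conR _ c
  normalise (e ⊕ e′) = addR _ (normalise e) (normalise e′)
  normalise (e ⊗ e′) = mulR _ (normalise e) (normalise e′)

  -- In a field with q elements -1 is q - 1, so subtraction can be written with natural constants,
  -- which make sense in both fields.
  negate : ∀ {n} → Expr n → Expr n
  negate e = con (suc r) ⊗ e

  -- By Fermat, 1 − (e − e′) ^ (q − 1) is the indicator function of the equation e = e′.
  equation : ∀ {n} → Expr n → Expr n → Expr n
  equation e e′ = con 1 ⊕ negate (power (e ⊕ negate e′) (suc r))

-- Evaluation of expressions and of their normal forms.

module Evaluation {r : ℕ} (F : FiniteField (2+ r)) where
  open FieldTheory F
  open Reduced r
  open Solver using (solve; _:+_; _:*_; _:=_) renaming (con to :con)

  -- Horner evaluation with coefficients read through `f`, so that it serves coefficients in `Red n`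
  -- and, with `id`, coefficients in the field.
  hor : ∀ {A : Set} {m} → (A → Carrier) → Vec A m → Carrier → Carrier
  hor f []       x = 0F
  hor f (a ∷ as) x = f a +F x *F hor f as x

  eval : ∀ {n} → Expr n → Vec Carrier n → Carrier
  eval (var i)  xs = lookup xs i
  eval (con c)  xs = c · 1F
  eval (e ⊕ e′) xs = eval e xs +F eval e′ xs
  eval (e ⊗ e′) xs = eval e xs *F eval e′ xs

  evalR : ∀ n → Red n → Vec Carrier n → Carrier
  evalR zero    c  []       = c · 1F
  evalR (suc n) as (x ∷ xs) = hor (λ a → evalR n a xs) as x

  fermat′ : ∀ x → x ^ 2+ r ≡ x
  fermat′ x with x ≟ 0F
  ... | yes refl = R.zeroˡ _
  ... | no x≢0   = trans (cong (x *F_) (fermat x≢0)) (R.*-identityʳ x)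

  module _ {A : Set} (f : A → Carrier) where

    hor-replicate : ∀ m {z} → f z ≡ 0F → ∀ x → hor f (replicate m z) x ≡ 0F
    hor-replicate zero    fz≡0 x = refl
    hor-replicate (suc m) fz≡0 x =
      trans (cong₂ _+F_ fz≡0 (trans (cong (x *F_) (hor-replicate m fz≡0 x)) (R.zeroʳ x))) (R.+-identityʳ 0F)

    hor-constant : ∀ m {z} → f z ≡ 0F → ∀ a x → hor f (a ∷ replicate m z) x ≡ f a
    hor-constant m fz≡0 a x =
      trans (cong (f a +F_) (trans (cong (x *F_) (hor-replicate m fz≡0 x)) (R.zeroʳ x))) (R.+-identityʳ (f a))

    hor-zipWith : ∀ {_∙_ : A → A → A} → (∀ a b → f (a ∙ b) ≡ f a +F f b) →
                  ∀ {m} (as bs : Vec A m) x → hor f (zipWith _∙_ as bs) x ≡ hor f as x +F hor f bs x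
    hor-zipWith homo []       []       x = sym (R.+-identityʳ 0F)
    hor-zipWith homo (a ∷ as) (b ∷ bs) x = trans
      (cong₂ (λ s t → s +F x *F t) (homo a b) (hor-zipWith homo as bs x))
      (solve 5 (λ a b x s t → (a :+ b) :+ x :* (s :+ t) := (a :+ x :* s) :+ (b :+ x :* t)) refl
        (f a) (f b) x (hor f as x) (hor f bs x))

    hor-map : ∀ {g : A → A} {c} → (∀ a → f (g a) ≡ c *F f a) →
              ∀ {m} (as : Vec A m) x → hor f (map g as) x ≡ c *F hor f as x
    hor-map         scale []       x = sym (R.zeroʳ _)
    hor-map {c = c} scale (a ∷ as) x = trans
      (cong₂ (λ s t → s +F x *F t) (scale a) (hor-map scale as x))
      (solve 4 (λ c a x s → c :* a :+ x :* (c :* s) := c :* (a :+ x :* s)) refl c (f a) x (hor f as x))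

    hor-unsnoc : ∀ {m} (as : Vec A (suc m)) x → let bs , b = unsnoc as in
                 hor f as x ≡ hor f bs x +F x ^ m *F f b
    hor-unsnoc {zero}  (a ∷ []) x =
      solve 2 (λ a x → a :+ x :* :con 0 := :con 0 :+ :con 1 :* a) refl (f a) x
    hor-unsnoc {suc m} (a ∷ as) x with unsnoc as | hor-unsnoc as x
    ... | bs , b | eq = trans (cong (λ s → f a +F x *F s) eq)
      (solve 5 (λ a x s t b → a :+ x :* (s :+ t :* b) := (a :+ x :* s) :+ (x :* t) :* b) refl
        (f a) x (hor f bs x) (x ^ m) (f b))

  evalR-zero : ∀ n xs → evalR n (zeroR n) xs ≡ 0F
  evalR-zero zero    []       = refl
  evalR-zero (suc n) (x ∷ xs) = hor-replicate _ (2+ r) (evalR-zero n xs) x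

  evalR-con : ∀ n c xs → evalR n (conR n c) xs ≡ c · 1F
  evalR-con zero    c []       = refl
  evalR-con (suc n) c (x ∷ xs) = trans (hor-constant _ (suc r) (evalR-zero n xs) _ x) (evalR-con n c xs)

  evalR-var : ∀ {n} (i : Fin n) xs → evalR n (varR i) xs ≡ lookup xs i
  evalR-var {suc n} zero    (x ∷ xs) = begin
    evalR n (zeroR n) xs +F x *F hor _ (conR n 1 ∷ replicate r (zeroR n)) x
      ≡⟨ cong₂ (λ s t → s +F x *F t) (evalR-zero n xs)
           (trans (hor-constant _ r (evalR-zero n xs) _ x) (evalR-con n 1 xs)) ⟩
    0F +F x *F (1F +F 0F)
      ≡⟨ solve 1 (λ x → :con 0 :+ x :* (:con 1 :+ :con 0) := x) refl x ⟩
    x ∎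
  evalR-var {suc n} (suc i) (x ∷ xs) = trans (hor-constant _ (suc r) (evalR-zero n xs) _ x) (evalR-var i xs)

  evalR-add : ∀ n a b xs → evalR n (addR n a b) xs ≡ evalR n a xs +F evalR n b xs
  evalR-add zero    a  b  []       = ×-homo-+ 1F a b
  evalR-add (suc n) as bs (x ∷ xs) = hor-zipWith _ (λ a b → evalR-add n a b xs) as bs x

  evalR-mulX : ∀ n as x xs → evalR (suc n) (mulX n as) (x ∷ xs) ≡ x *F evalR (suc n) as (x ∷ xs)
  evalR-mulX n as x xs with unsnoc as | hor-unsnoc (λ a → evalR n a xs) as x
  ... | b₀ ∷ bs , b | eq = begin
    f (zeroR n) +F x *F (f (addR n b₀ b) +F x *F s)
      ≡⟨ cong₂ (λ u v → u +F x *F (v +F x *F s)) (evalR-zero n xs) (evalR-add n b₀ b xs) ⟩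
    0F +F x *F (f b₀ +F f b +F x *F s)
      ≡⟨ solve 4 (λ x b₀ b s → :con 0 :+ x :* (b₀ :+ b :+ x :* s) := x :* (b₀ :+ x :* s) :+ x :* b) refl x (f b₀) (f b) s ⟩
    x *F (f b₀ +F x *F s) +F x *F f b
      -- `mulX` has put `b` in degree 1; Fermat rewrites this `x` as `x ^ q`, the degree that the
      -- top coefficient reaches after multiplication by `x`.
      ≡⟨ cong (λ u → x *F (f b₀ +F x *F s) +F u *F f b) (fermat′ x) ⟨
    x *F (f b₀ +F x *F s) +F x ^ 2+ r *F f b
      ≡⟨ solve 4 (λ x t u b → x :* t :+ (x :* u) :* b := x :* (t :+ u :* b)) refl x (f b₀ +F x *F s) (x ^ suc r) (f b) ⟩
    x *F (f b₀ +F x *F s +F x ^ suc r *F f b)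
      ≡⟨ cong (x *F_) eq ⟨
    x *F hor f as x ∎
    where
    f = λ a → evalR n a xs
    s = hor f bs x

  evalR-mul : ∀ n a b xs → evalR n (mulR n a b) xs ≡ evalR n a xs *F evalR n b xs
  evalR-mul zero    a  b []       = ×1-homo-* a b
  evalR-mul (suc n) as b (x ∷ xs) = go as
    where
    f = λ a → evalR n a xs
    step = λ a c → addR (suc n) (map (mulR n a) b) (mulX n c)
    -- The length is arbitrary because the tails met by the fold have fewer than q coefficients.
    go : ∀ {m} (as : Vec (Red n) m) →
         evalR (suc n) (Vec.foldr′ step (zeroR (suc n)) as) (x ∷ xs) ≡ hor f as x *F hor f b x
    go []       = trans (evalR-zero (suc n) (x ∷ xs)) (sym (R.zeroˡ _))
    go (a ∷ as) = begin
      evalR (suc n) (step a c) (x ∷ xs)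
        ≡⟨ evalR-add (suc n) (map (mulR n a) b) (mulX n c) (x ∷ xs) ⟩
      hor f (map (mulR n a) b) x +F evalR (suc n) (mulX n c) (x ∷ xs)
        ≡⟨ cong₂ _+F_ (hor-map f (λ b → evalR-mul n a b xs) b x) (evalR-mulX n c x xs) ⟩
      f a *F hor f b x +F x *F evalR (suc n) c (x ∷ xs)
        ≡⟨ cong (λ u → f a *F hor f b x +F x *F u) (go as) ⟩
      f a *F hor f b x +F x *F (hor f as x *F hor f b x)
        ≡⟨ solve 4 (λ a b x s → a :* b :+ x :* (s :* b) := (a :+ x :* s) :* b) refl (f a) (hor f b x) x (hor f as x) ⟩
      (f a +F x *F hor f as x) *F hor f b x ∎
      where
      c = Vec.foldr′ step (zeroR (suc n)) as

  evalR-normalise : ∀ {n} (e : Expr n) xs → evalR n (normalise e) xs ≡ eval e xs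
  evalR-normalise (var i)  xs = evalR-var i xs
  evalR-normalise (con c)  xs = evalR-con _ c xs
  evalR-normalise (e ⊕ e′) xs = trans (evalR-add _ (normalise e) _ xs) (cong₂ _+F_ (evalR-normalise e xs) (evalR-normalise e′ xs))
  evalR-normalise (e ⊗ e′) xs = trans (evalR-mul _ (normalise e) _ xs) (cong₂ _*F_ (evalR-normalise e xs) (evalR-normalise e′ xs))

  -- Division by X - a, and polynomials with as many roots as coefficients.

  hor-map-id : ∀ {A : Set} (f : A → Carrier) {m} (as : Vec A m) x → hor id (map f as) x ≡ hor f as x
  hor-map-id f []       x = refl
  hor-map-id f (a ∷ as) x = cong (λ s → f a +F x *F s) (hor-map-id f as x)

  -- Synthetic division by X - a: the coefficients of the quotient are the values at `a` of the
  -- successive tails of the polynomial.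
  quotient : ∀ {m} → Carrier → Vec Carrier (suc m) → Vec Carrier m
  quotient {zero}  a (c ∷ [])      = []
  quotient {suc m} a (c ∷ c′ ∷ cs) = hor id (c′ ∷ cs) a ∷ quotient a (c′ ∷ cs)

  -- Both sides of p(x) − p(a) = (x − a) s(x) moved so that no subtraction occurs.
  quotient-spec : ∀ {m} a (p : Vec Carrier (suc m)) x →
                  hor id p x +F a *F hor id (quotient a p) x ≡ hor id p a +F x *F hor id (quotient a p) x
  quotient-spec {zero}  a (c ∷ [])      x =
    solve 3 (λ c a x → (c :+ x :* :con 0) :+ a :* :con 0 := (c :+ a :* :con 0) :+ x :* :con 0) refl c a x
  quotient-spec {suc m} a (c ∷ c′ ∷ cs) x = begin
    c +F x *F px +F a *F (pa +F x *F s)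
      ≡⟨ solve 6 (λ c x px a pa s → c :+ x :* px :+ a :* (pa :+ x :* s) := c :+ a :* pa :+ x :* (px :+ a :* s)) refl c x px a pa s ⟩
    c +F a *F pa +F x *F (px +F a *F s)
      ≡⟨ cong (λ u → c +F a *F pa +F x *F u) (quotient-spec a (c′ ∷ cs) x) ⟩
    c +F a *F pa +F x *F (pa +F x *F s) ∎
    where
    px = hor id (c′ ∷ cs) x
    pa = hor id (c′ ∷ cs) a
    s  = hor id (quotient a (c′ ∷ cs)) x

  -- p is determined by its remainder p(a) and its quotient. The head of the quotient is the value
  -- of the tail at `a`, so its vanishing is the root hypothesis for the recursion.
  quotient-zero : ∀ {m} a (p : Vec Carrier (suc m)) → hor id p a ≡ 0F →
                  (∀ j → lookup (quotient a p) j ≡ 0F) → ∀ j → lookup p j ≡ 0F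
  quotient-zero {zero}  a (c ∷ [])          pa≡0 q≡0 zero =
    trans (solve 2 (λ c a → c := c :+ a :* :con 0) refl c a) pa≡0
  quotient-zero {suc m} a (c ∷ p@(c′ ∷ cs)) pa≡0 q≡0 zero = begin
    c                   ≡⟨ solve 2 (λ c a → c := c :+ a :* :con 0) refl c a ⟩
    c +F a *F 0F        ≡⟨ cong (λ u → c +F a *F u) (q≡0 zero) ⟨
    c +F a *F hor id p a  ≡⟨ pa≡0 ⟩
    0F                  ∎
  quotient-zero {suc m} a (c ∷ c′ ∷ cs) pa≡0 q≡0 (suc j) = quotient-zero a (c′ ∷ cs) (q≡0 zero) (q≡0 ∘ suc) j

  -- Division by X - a at the first root `a` leaves a quotient with one coefficient fewer, which
  -- vanishes at all the other roots because they differ from `a`.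
  roots⇒zero : ∀ {m} (p : Vec Carrier m) (x : Fin m → Carrier) → (∀ {i j} → x i ≡ x j → i ≡ j) →
               (∀ i → hor id p (x i) ≡ 0F) → ∀ j → lookup p j ≡ 0F
  roots⇒zero {suc m} p x x-inj p≡0 =
    quotient-zero a p (p≡0 zero) (roots⇒zero (quotient a p) (x ∘ suc) (Fin.suc-injective ∘ x-inj) s≡0)
    where
    a = x zero
    s≡0 : ∀ i → hor id (quotient a p) (x (suc i)) ≡ 0F
    s≡0 i = x*y≡0⇒y≡0 {y R.- a} y-a≢0 (begin
      (y R.- a) *F s        ≡⟨ RP.[y-z]x≈yx-zx s y a ⟩
      y *F s R.- a *F s     ≡⟨ cong (R._- a *F s) (sym eq) ⟩
      a *F s R.- a *F s     ≡⟨ R.-‿inverseʳ (a *F s) ⟩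
      0F                    ∎)
      where
      y = x (suc i)
      s = hor id (quotient a p) y
      y-a≢0 : y R.- a ≢ 0F
      y-a≢0 eq = contradiction (x-inj (x-y≡0⇒x≡y eq)) λ ()
      eq : a *F s ≡ y *F s
      eq = begin
        a *F s                ≡⟨ R.+-identityˡ _ ⟨
        0F +F a *F s          ≡⟨ cong (_+F a *F s) (p≡0 (suc i)) ⟨
        hor id p y +F a *F s  ≡⟨ quotient-spec a p y ⟩
        hor id p a +F y *F s  ≡⟨ cong (_+F y *F s) (p≡0 zero) ⟩
        0F +F y *F s          ≡⟨ R.+-identityˡ _ ⟩
        y *F s                ∎

  -- With `xs` fixed, this is a polynomial in the first variable with q coefficients and all q field
  -- elements as roots.
  evalR-coefficients : ∀ n (as : Red (suc n)) → (∀ xs → evalR (suc n) as xs ≡ 0F) →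
                       ∀ j xs → evalR n (lookup as j) xs ≡ 0F
  evalR-coefficients n as as≡0 j xs = trans (sym (Vec.lookup-map j (λ a → evalR n a xs) as))
    (roots⇒zero (map (λ a → evalR n a xs) as) E.to to-injective
      (λ i → trans (hor-map-id (λ a → evalR n a xs) as (E.to i)) (as≡0 (E.to i ∷ xs))) j)

  hor-zero : ∀ {A : Set} (f : A → Carrier) {m} (as : Vec A m) → (∀ j → f (lookup as j) ≡ 0F) → ∀ x → hor f as x ≡ 0F
  hor-zero f []       f≡0 x = refl
  hor-zero f (a ∷ as) f≡0 x =
    trans (cong₂ (λ s t → s +F x *F t) (f≡0 zero) (hor-zero f as (f≡0 ∘ suc) x))
          (trans (R.+-identityˡ _) (R.zeroʳ x))

  eval-negate : ∀ {n} (e : Expr n) xs → eval (negate e) xs ≡ -F eval e xs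
  eval-negate e xs = RP.+-inverseʳ-unique _ _ (begin
    x +F (suc r · 1F) *F x    ≡⟨ solve 2 (λ x n → x :+ n :* x := (:con 1 :+ n) :* x) refl x (suc r · 1F) ⟩
    (2+ r · 1F) *F x          ≡⟨ cong (_*F x) size·1≡0 ⟩
    0F *F x                   ≡⟨ R.zeroˡ x ⟩
    0F                        ∎)
    where x = eval e xs

  eval-power : ∀ {n} (e : Expr n) k xs → eval (power e k) xs ≡ eval e xs ^ k
  eval-power e zero    xs = R.+-identityʳ 1F
  eval-power e (suc k) xs = cong (eval e xs *F_) (eval-power e k xs)

  module _ {n} (e e′ : Expr n) (xs : Vec Carrier n) where
    private
      d = eval (e ⊕ negate e′) xs

      d≡ : d ≡ eval e xs R.- eval e′ xs
      d≡ = cong (eval e xs +F_) (eval-negate e′ xs)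

      equation≡ : eval (equation e e′) xs ≡ 1F R.- d ^ suc r
      equation≡ = cong₂ _+F_ (R.+-identityʳ 1F)
        (trans (eval-negate (power (e ⊕ negate e′) (suc r)) xs) (cong -F_ (eval-power (e ⊕ negate e′) (suc r) xs)))

    equation-sound : eval (equation e e′) xs ≢ 0F → eval e xs ≡ eval e′ xs
    equation-sound neq with d ≟ 0F
    ... | yes d≡0 = x-y≡0⇒x≡y (trans (sym d≡) d≡0)
    ... | no d≢0  = contradiction (trans equation≡ (trans (cong (λ u → 1F R.- u) (fermat d≢0)) (R.-‿inverseʳ 1F))) neq

    equation-complete : eval e xs ≡ eval e′ xs → eval (equation e e′) xs ≢ 0F
    equation-complete eq eq0 = 0≢1 (begin
      0F                      ≡⟨ eq0 ⟨
      eval (equation e e′) xs ≡⟨ equation≡ ⟩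
      1F R.- d ^ suc r        ≡⟨ cong (λ u → 1F R.- u *F d ^ r) (trans d≡ (RP.x≈y⇒x∙y⁻¹≈ε eq)) ⟩
      1F R.- 0F *F d ^ r      ≡⟨ cong (λ u → 1F R.- u) (R.zeroˡ _) ⟩
      1F R.- 0F               ≡⟨ cong (1F +F_) RP.-0#≈0# ⟩
      1F +F 0F                ≡⟨ R.+-identityʳ 1F ⟩
      1F                      ∎)

  nonzero-factors : ∀ {x y} → x *F y ≢ 0F → x ≢ 0F × y ≢ 0F
  nonzero-factors {x} {y} xy≢0 = (λ { refl → xy≢0 (R.zeroˡ y) }) , (λ { refl → xy≢0 (R.zeroʳ x) })

  prodE-factor : ∀ {n m} (f : Fin m → Expr n) xs → eval (prodE f) xs ≢ 0F → ∀ i → eval (f i) xs ≢ 0F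
  prodE-factor f xs neq zero    = proj₁ (nonzero-factors neq)
  prodE-factor f xs neq (suc i) = prodE-factor (f ∘ suc) xs (proj₂ (nonzero-factors neq)) i

  prodE-nonzero : ∀ {n m} (f : Fin m → Expr n) xs → (∀ i → eval (f i) xs ≢ 0F) → eval (prodE f) xs ≢ 0F
  prodE-nonzero {m = zero}  f xs f≢0 eq = 0≢1 (sym (trans (sym (R.+-identityʳ 1F)) eq))
  prodE-nonzero {m = suc m} f xs f≢0 = *-nonzero (f≢0 zero) (prodE-nonzero (f ∘ suc) xs (f≢0 ∘ suc))

-- Uniqueness of the field with q elements

record FieldIso {q : ℕ} (F₁ F₂ : FiniteField q) : Set where
  private
    module F₁ = FiniteField F₁
    module F₂ = FiniteField F₂
  field
    φ    : F₁.Carrier → F₂.Carrier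
    ψ    : F₂.Carrier → F₁.Carrier
    ψ∘φ  : ∀ x → ψ (φ x) ≡ x
    φ∘ψ  : ∀ y → φ (ψ y) ≡ y
    φ-+  : ∀ x y → φ (x F₁.+F y) ≡ φ x F₂.+F φ y
    φ-*  : ∀ x y → φ (x F₁.*F y) ≡ φ x F₂.*F φ y

-- A missed value could be punched out of the codomain, leaving an injection of `Fin (suc n)` into
-- `Fin n`.
injective⇒surjective : ∀ {n} (f : Fin n → Fin n) → (∀ {i j} → f i ≡ f j → i ≡ j) → ∀ j → ∃ λ i → f i ≡ j
injective⇒surjective {suc n} f f-inj j with Fin.any? (λ i → f i Fin.≟ j)
... | yes found = found
... | no ¬found = contradiction (Fin.injective⇒≤ {f = λ i → Fin.punchOut (missed i)}
                    (λ {i} {k} eq → f-inj (Fin.punchOut-injective (missed i) (missed k) eq))) ℕ.1+n≰n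
  where
  missed : ∀ i → j ≢ f i
  missed i eq = ¬found (i , sym eq)

module _ {r : ℕ} (F₁ F₂ : FiniteField (2+ r)) where
  open Reduced r
  private
    module F₁ = FieldTheory F₁
    module F₂ = FieldTheory F₂
    module E₁ = Evaluation F₁
    module E₂ = Evaluation F₂

  module _ (sameChar : ∀ c → c F₂.· F₂.1F ≡ F₂.0F → c F₁.· F₁.1F ≡ F₁.0F) where

    -- Vanishing everywhere on F₂ passes to the coefficients, variable after variable, until natural
    -- constants remain; for these `sameChar` leads to F₁, and vanishing coefficients give vanishing
    -- values.
    transferR : ∀ n (a : Red n) → (∀ xs → E₂.evalR n a xs ≡ F₂.0F) → ∀ xs → E₁.evalR n a xs ≡ F₁.0F
    transferR zero    a  a≡0  []       = sameChar a (a≡0 [])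
    transferR (suc n) as as≡0 (x ∷ xs) = E₁.hor-zero _ as
      (λ j → transferR n (lookup as j) (E₂.evalR-coefficients n as as≡0 j) xs) x

    -- `normalise` depends on r alone, so one normal form represents the expression in both fields.
    transfer : ∀ {n} (e : Expr n) → (∀ xs → E₂.eval e xs ≡ F₂.0F) → ∀ xs → E₁.eval e xs ≡ F₁.0F
    transfer e e≡0 xs = trans (sym (E₁.evalR-normalise e xs))
      (transferR _ (normalise e) (λ ys → trans (E₂.evalR-normalise e ys) (e≡0 ys)) xs)

    transfer-nonzero : ∀ {n} (e : Expr n) xs → E₁.eval e xs ≢ F₁.0F → ∃ λ ys → E₂.eval e ys ≢ F₂.0F
    transfer-nonzero {n} e xs e≢0 with F₂.searchVec n (λ ys → ¬? (E₂.eval e ys F₂.≟ F₂.0F))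
    ... | yes found = found
    ... | no ¬found = contradiction
      (transfer e (λ ys → decidable-stable (E₂.eval e ys F₂.≟ F₂.0F) (λ neq → ¬found (ys , neq))) xs) e≢0

    private
      open F₁.E using (to; from)

      -- One variable for each element of F₁; a common solution of these equations in F₂ is a homomorphism.
      sumEq mulEq : Fin (2+ r) → Fin (2+ r) → Expr (2+ r)
      sumEq i j = equation (var (from (to i F₁.+F to j))) (var i ⊕ var j)
      mulEq i j = equation (var (from (to i F₁.*F to j))) (var i ⊗ var j)

      oneEq : Expr (2+ r)
      oneEq = equation (var (from F₁.1F)) (con 1)

      -- A product is nonzero exactly when all its factors are, so one polynomial states all the
      -- equations together. `oneEq` excludes the zero map.
      homEq : Expr (2+ r)
      homEq = oneEq ⊗ (prodE (λ i → prodE (sumEq i)) ⊗ prodE (λ i → prodE (mulEq i)))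

      elements : Vec F₁.Carrier (2+ r)
      elements = tabulate to

      lookup-elements : ∀ i → lookup elements i ≡ to i
      lookup-elements = Vec.lookup∘tabulate to

      lookup-from : ∀ x → lookup elements (from x) ≡ x
      lookup-from x = trans (lookup-elements (from x)) (F₁.to-from x)

      homEq-elements : E₁.eval homEq elements ≢ F₁.0F
      homEq-elements = F₁.*-nonzero
        (E₁.equation-complete (var (from F₁.1F)) (con 1) elements (trans (lookup-from F₁.1F) (sym (F₁.R.+-identityʳ F₁.1F))))
        (F₁.*-nonzero
          (E₁.prodE-nonzero (λ i → prodE (sumEq i)) elements λ i → E₁.prodE-nonzero (sumEq i) elements λ j →
            E₁.equation-complete (var (from (to i F₁.+F to j))) (var i ⊕ var j) elements
              (trans (lookup-from _) (sym (cong₂ F₁._+F_ (lookup-elements i) (lookup-elements j)))))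
          (E₁.prodE-nonzero (λ i → prodE (mulEq i)) elements λ i → E₁.prodE-nonzero (mulEq i) elements λ j →
            E₁.equation-complete (var (from (to i F₁.*F to j))) (var i ⊗ var j) elements
              (trans (lookup-from _) (sym (cong₂ F₁._*F_ (lookup-elements i) (lookup-elements j))))))

      abstract
        solution : ∃ λ ys → E₂.eval homEq ys ≢ F₂.0F
        solution = transfer-nonzero homEq elements homEq-elements

      ys : Vec F₂.Carrier (2+ r)
      ys = proj₁ solution

      φ : F₁.Carrier → F₂.Carrier
      φ x = lookup ys (from x)

      φ-binary : ∀ (_∙_ : F₁.Carrier → F₁.Carrier → F₁.Carrier) (_∙′_ : F₂.Carrier → F₂.Carrier → F₂.Carrier) →
                 (∀ i j → φ (to i ∙ to j) ≡ lookup ys i ∙′ lookup ys j) →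
                 ∀ x y → φ (x ∙ y) ≡ φ x ∙′ φ y
      φ-binary _∙_ _∙′_ h x y =
        trans (cong₂ (λ u v → φ (u ∙ v)) (sym (F₁.to-from x)) (sym (F₁.to-from y))) (h (from x) (from y))

      factors = E₂.nonzero-factors (proj₂ (E₂.nonzero-factors (proj₂ solution)))

      φ-1 : φ F₁.1F ≡ F₂.1F
      φ-1 = trans (E₂.equation-sound (var (from F₁.1F)) (con 1) ys (proj₁ (E₂.nonzero-factors (proj₂ solution))))
                  (F₂.R.+-identityʳ F₂.1F)

      φ-+ : ∀ x y → φ (x F₁.+F y) ≡ φ x F₂.+F φ y
      φ-+ = φ-binary F₁._+F_ F₂._+F_ λ i j →
        E₂.equation-sound (var (from (to i F₁.+F to j))) (var i ⊕ var j) ys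
          (E₂.prodE-factor (sumEq i) ys (E₂.prodE-factor (λ i → prodE (sumEq i)) ys (proj₁ factors) i) j)

      φ-* : ∀ x y → φ (x F₁.*F y) ≡ φ x F₂.*F φ y
      φ-* = φ-binary F₁._*F_ F₂._*F_ λ i j →
        E₂.equation-sound (var (from (to i F₁.*F to j))) (var i ⊗ var j) ys
          (E₂.prodE-factor (mulEq i) ys (E₂.prodE-factor (λ i → prodE (mulEq i)) ys (proj₂ factors) i) j)

      φ-nonzero : ∀ {x} → x ≢ F₁.0F → φ x ≢ F₂.0F
      φ-nonzero {x} x≢0 φx≡0 with z , xz≡1 ← F₁.inverse x x≢0 = F₂.0≢1 (begin
        F₂.0F              ≡⟨ F₂.R.zeroˡ (φ z) ⟨
        F₂.0F F₂.*F φ z    ≡⟨ cong (F₂._*F φ z) φx≡0 ⟨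
        φ x F₂.*F φ z      ≡⟨ φ-* x z ⟨
        φ (x F₁.*F z)      ≡⟨ cong φ xz≡1 ⟩
        φ F₁.1F            ≡⟨ φ-1 ⟩
        F₂.1F              ∎)

      φ-injective : ∀ {x y} → φ x ≡ φ y → x ≡ y
      φ-injective {x} {y} eq = decidable-stable (x F₁.≟ y) λ x≢y →
        φ-nonzero {x F₁.R.- y} (x≢y ∘ F₁.x-y≡0⇒x≡y)
          (F₂.RP.+-identityˡ-unique (φ (x F₁.R.- y)) (φ y) (begin
            φ (x F₁.R.- y) F₂.+F φ y  ≡⟨ φ-+ (x F₁.R.- y) y ⟨
            φ (x F₁.R.- y F₁.+F y)    ≡⟨ cong φ (F₁.RP.//-rightDividesˡ y x) ⟩
            φ x                       ≡⟨ eq ⟩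
            φ y                       ∎))

      φ-surjective : ∀ y → ∃ λ x → φ x ≡ y
      φ-surjective y with i , eq ← injective⇒surjective (λ i → F₂.E.from (φ (to i)))
                                     (λ {i} {j} eq → F₁.to-injective (φ-injective
                                       (trans (sym (F₂.to-from (φ (to i)))) (trans (cong F₂.E.to eq) (F₂.to-from (φ (to j)))))))
                                     (F₂.E.from y)
        = to i , trans (sym (F₂.to-from (φ (to i)))) (trans (cong F₂.E.to eq) (F₂.to-from y))

    fieldIso : FieldIso F₁ F₂
    fieldIso = record
      { φ   = φ
      ; ψ   = λ y → proj₁ (φ-surjective y)
      ; ψ∘φ = λ x → φ-injective (proj₂ (φ-surjective (φ x)))
      ; φ∘ψ = λ y → proj₂ (φ-surjective y)
      ; φ-+ = φ-+
      ; φ-* = φ-*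
      }

-- In either field c · 1 = 0 means that p divides c, a condition on c and q alone; this supplies
-- `sameChar`.
finiteField-unique : ∀ {q} → IsPrimePower q → (F₁ F₂ : FiniteField q) → FieldIso F₁ F₂
finiteField-unique {q} (p , k , p-prime , q≡p^k) F₁ F₂ with r , refl ← FieldTheory.size≥2 F₁ =
  fieldIso F₁ F₂ (λ c c·1≡0 → FieldTheory.∣⇒·1≡0 F₁ {p} {k} p-prime q≡p^k {c} (FieldTheory.·1≡0⇒∣ F₂ {p} {k} p-prime q≡p^k {c} c·1≡0))

fieldIso-sym : ∀ {q} {F₁ F₂ : FiniteField q} → FieldIso F₁ F₂ → FieldIso F₂ F₁
fieldIso-sym {F₁ = F₁} {F₂} iso = record
  { φ = ψ ; ψ = φ ; ψ∘φ = φ∘ψ ; φ∘ψ = ψ∘φ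
  ; φ-+ = λ x y → φ-injective (trans (φ∘ψ _) (sym (trans (φ-+ (ψ x) (ψ y)) (cong₂ F₂._+F_ (φ∘ψ x) (φ∘ψ y)))))
  ; φ-* = λ x y → φ-injective (trans (φ∘ψ _) (sym (trans (φ-* (ψ x) (ψ y)) (cong₂ F₂._*F_ (φ∘ψ x) (φ∘ψ y)))))
  }
  where
  open FieldIso iso
  module F₂ = FiniteField F₂
  φ-injective : ∀ {x y} → φ x ≡ φ y → x ≡ y
  φ-injective eq = trans (sym (ψ∘φ _)) (trans (cong ψ eq) (ψ∘φ _))

-- Field isomorphisms induce graph isomorphisms.

map-inverse : ∀ {A B : Set} {f : A → B} {g : B → A} → (∀ x → g (f x) ≡ x) →
              ∀ {n} (v : Vec A n) → map g (map f v) ≡ v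
map-inverse {f = f} {g} g∘f v = trans (sym (Vec.map-∘ g f v)) (trans (Vec.map-cong g∘f v) (Vec.map-id v))

module Transport {q} {F₁ F₂ : FiniteField q} (iso : FieldIso F₁ F₂) (ν : ℕ) where
  open FieldIso iso
  private
    module F₁ = FieldTheory F₁
    module F₂ = FieldTheory F₂
    module S₁ = Symplectic F₁ ν
    module S₂ = Symplectic F₂ ν

  φ-0 : φ F₁.0F ≡ F₂.0F
  φ-0 = F₂.RP.x+x≈x⇒x≈0 _ (trans (sym (φ-+ F₁.0F F₁.0F)) (cong φ (F₁.R.+-identityʳ F₁.0F)))

  φ-neg : ∀ x → φ (F₁.-F x) ≡ F₂.-F φ x
  φ-neg x = F₂.RP.+-inverseʳ-unique _ _ (trans (sym (φ-+ x _)) (trans (cong φ (F₁.R.-‿inverseʳ x)) φ-0))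

  φ-∑ : ∀ n {f : Fin n → F₁.Carrier} {g : Fin n → F₂.Carrier} → (∀ i → g i ≡ φ (f i)) → S₂.∑ n g ≡ φ (S₁.∑ n f)
  φ-∑ zero    eq = sym φ-0
  φ-∑ (suc n) eq = trans (cong₂ F₂._+F_ (eq zero) (φ-∑ n (eq ∘ suc))) (sym (φ-+ _ _))

  φ-form : ∀ α β → S₂.⟪ map φ α , map φ β ⟫ ≡ φ S₁.⟪ α , β ⟫
  φ-form α β = φ-∑ ν λ i → trans
    (cong₂ F₂._+F_ (product (i Fin.↑ˡ ν) (ν Fin.↑ʳ i))
                   (trans (cong F₂.-F_ (product (ν Fin.↑ʳ i) (i Fin.↑ˡ ν))) (sym (φ-neg _))))
    (sym (φ-+ _ _))
    where
    product : ∀ i j → lookup (map φ α) i F₂.*F lookup (map φ β) j ≡ φ (lookup α i F₁.*F lookup β j)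
    product i j = trans (cong₂ F₂._*F_ (Vec.lookup-map i φ α) (Vec.lookup-map j φ β)) (sym (φ-* _ _))

  map-zero : map φ S₁.zeroRow ≡ S₂.zeroRow
  map-zero = trans (Vec.map-replicate φ F₁.0F (ν ℕ.+ ν)) (cong (replicate _) φ-0)

  map-+ : ∀ {n} (u v : Vec F₁.Carrier n) → map φ (zipWith F₁._+F_ u v) ≡ zipWith F₂._+F_ (map φ u) (map φ v)
  map-+ []       []       = refl
  map-+ (x ∷ xs) (y ∷ ys) = cong₂ _∷_ (φ-+ x y) (map-+ xs ys)

  map-· : ∀ c v → map φ (c S₁.·R v) ≡ φ c S₂.·R map φ v
  map-· c v = trans (sym (Vec.map-∘ φ (c F₁.*F_) v)) (trans (Vec.map-cong (φ-* c) v) (Vec.map-∘ (φ c F₂.*F_) φ v))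

  -- The preimage under coordinatewise `φ` is taken, since for Boolean membership functions it is
  -- plain composition.
  pullback : S₂.ProperSubspace → S₁.ProperSubspace
  pullback A = record
    { subspace = record
      { mem   = λ v → A.mem (map φ v)
      ; mem-0 = trans (cong A.mem map-zero) A.mem-0
      ; mem-+ = λ u v u∈ v∈ → trans (cong A.mem (map-+ u v)) (A.mem-+ _ _ u∈ v∈)
      ; mem-· = λ c v v∈ → trans (cong A.mem (map-· c v)) (A.mem-· (φ c) _ v∈)
      }
    ; nonzero = let v , v≢0 , v∈A = S₂.ProperSubspace.nonzero A in
        map ψ v ,
        (λ eq → v≢0 (trans (sym (map-inverse φ∘ψ v)) (trans (cong (map φ) eq) map-zero))) ,
        trans (cong A.mem (map-inverse φ∘ψ v)) v∈A
    ; nonfull = let v , v∉A = S₂.ProperSubspace.nonfull A in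
        map ψ v , trans (cong A.mem (map-inverse φ∘ψ v)) v∉A
    }
    where
    module A = S₂.Subspace (S₂.ProperSubspace.subspace A)

  pullback-adj : ∀ A B → S₂.Adjacent A B → S₁.Adjacent (pullback A) (pullback B)
  pullback-adj A B A~B α β α∈A β∈B = begin
    S₁.⟪ α , β ⟫                  ≡⟨ ψ∘φ _ ⟨
    ψ (φ S₁.⟪ α , β ⟫)            ≡⟨ cong ψ (φ-form α β) ⟨
    ψ S₂.⟪ map φ α , map φ β ⟫    ≡⟨ cong ψ (A~B (map φ α) (map φ β) α∈A β∈B) ⟩
    ψ F₂.0F                       ≡⟨ cong ψ φ-0 ⟨
    ψ (φ F₁.0F)                   ≡⟨ ψ∘φ _ ⟩
    F₁.0F                         ∎

spiIso : ∀ {q} {F₁ F₂ : FiniteField q} → FieldIso F₁ F₂ → ∀ ν → Spi F₁ ν ≅G Spi F₂ ν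
spiIso {q} {F₁} {F₂} iso ν = record
  -- Preimages reverse direction: `to` pulls back along `ψ`, `from` along `φ`.
  { to        = T₂.pullback
  ; from      = T₁.pullback
  ; to-cong   = λ A≈B v → A≈B (map ψ v)
  ; from-cong = λ A≈B v → A≈B (map φ v)
  ; from∘to   = λ A v → cong (S₁.Subspace.mem (S₁.ProperSubspace.subspace A)) (map-inverse ψ∘φ v)
  ; to∘from   = λ B v → cong (S₂.Subspace.mem (S₂.ProperSubspace.subspace B)) (map-inverse φ∘ψ v)
  ; adj-to    = T₂.pullback-adj
  -- The adjacency is pulled back a second time; pulling back twice returns the subspaces with their
  -- original members.
  ; adj-from  = λ A B A~B α β α∈A β∈B → T₁.pullback-adj (T₂.pullback A) (T₂.pullback B) A~B α β
      (trans (cong (S₁.Subspace.mem (S₁.ProperSubspace.subspace A)) (map-inverse ψ∘φ α)) α∈A)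
      (trans (cong (S₁.Subspace.mem (S₁.ProperSubspace.subspace B)) (map-inverse ψ∘φ β)) β∈B)
  }
  where
  open FieldIso iso
  module S₁ = Symplectic F₁ ν
  module S₂ = Symplectic F₂ ν
  module T₁ = Transport iso ν
  module T₂ = Transport (fieldIso-sym iso) ν

-- Vectors over a finite field

module Vectors {q : ℕ} (F : FiniteField q) where
  open FieldTheory F
  open Solver using (solve; _:+_; _:*_; _:=_) renaming (con to :con)

  infixl 6 _+ᵥ_
  infixr 7 _·ᵥ_

  _+ᵥ_ : ∀ {n} → Vec Carrier n → Vec Carrier n → Vec Carrier n
  _+ᵥ_ = zipWith _+F_

  _·ᵥ_ : ∀ {n} → Carrier → Vec Carrier n → Vec Carrier n
  c ·ᵥ v = map (c *F_) v

  0ᵥ : ∀ {n} → Vec Carrier n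
  0ᵥ = replicate _ 0F

  infix 4 _≟ᵥ_
  _≟ᵥ_ : ∀ {n} → DecidableEquality (Vec Carrier n)
  _≟ᵥ_ = Vec.≡-dec _≟_

  ·ᵥ-identity : ∀ {n} (v : Vec Carrier n) → 1F ·ᵥ v ≡ v
  ·ᵥ-identity v = trans (Vec.map-cong R.*-identityˡ v) (Vec.map-id v)

  ·ᵥ-assoc : ∀ {n} c d (v : Vec Carrier n) → (c *F d) ·ᵥ v ≡ c ·ᵥ d ·ᵥ v
  ·ᵥ-assoc c d v = trans (Vec.map-cong (R.*-assoc c d) v) (Vec.map-∘ (c *F_) (d *F_) v)

  ·ᵥ-zeroˡ : ∀ {n} (v : Vec Carrier n) → 0F ·ᵥ v ≡ 0ᵥ
  ·ᵥ-zeroˡ []       = refl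
  ·ᵥ-zeroˡ (x ∷ xs) = cong₂ _∷_ (R.zeroˡ x) (·ᵥ-zeroˡ xs)

  ·ᵥ-zeroʳ : ∀ {n} c → c ·ᵥ 0ᵥ {n} ≡ 0ᵥ
  ·ᵥ-zeroʳ {n} c = trans (Vec.map-replicate (c *F_) 0F n) (cong (replicate n) (R.zeroʳ c))

  +ᵥ-cancelˡ : ∀ {n} (u v w : Vec Carrier n) → u +ᵥ v ≡ u +ᵥ w → v ≡ w
  +ᵥ-cancelˡ []       []       []       eq = refl
  +ᵥ-cancelˡ (u ∷ us) (v ∷ vs) (w ∷ ws) eq with hd , tl ← Vec.∷-injective eq =
    cong₂ _∷_ (RP.+-cancelˡ u v w hd) (+ᵥ-cancelˡ us vs ws tl)

  ·ᵥ-inverse : ∀ {n c d} → d *F c ≡ 1F → (v : Vec Carrier n) → d ·ᵥ c ·ᵥ v ≡ v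
  ·ᵥ-inverse {c = c} {d} dc≡1 v = trans (sym (·ᵥ-assoc d c v)) (trans (cong (_·ᵥ v) dc≡1) (·ᵥ-identity v))

  inverseˡ : ∀ {x} → x ≢ 0F → ∃ λ y → y *F x ≡ 1F
  inverseˡ {x} x≢0 with y , xy≡1 ← inverse x x≢0 = y , trans (R.*-comm y x) xy≡1

  -- Stated in every dimension, so that induction on the number of coordinates can leave the
  -- symplectic space.
  record IsSubspace {n} (P : Vec Carrier n → Set) : Set where
    field
      dec      : Decidable P
      zero-mem : P 0ᵥ
      +-mem    : ∀ {u v} → P u → P v → P (u +ᵥ v)
      ·-mem    : ∀ c {v} → P v → P (c ·ᵥ v)

    ·-mem⁻¹ : ∀ {c v} → c ≢ 0F → P (c ·ᵥ v) → P v
    ·-mem⁻¹ {c} {v} c≢0 p with d , dc≡1 ← inverseˡ c≢0 = subst P (·ᵥ-inverse dc≡1 v) (·-mem d p)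

  isSubspace-0 : ∀ {n} → IsSubspace {n} (_≡ 0ᵥ)
  isSubspace-0 = record
    { dec      = _≟ᵥ 0ᵥ
    ; zero-mem = refl
    ; +-mem    = λ { refl refl → Vec.zipWith-identityˡ R.+-identityˡ 0ᵥ }
    ; ·-mem    = λ { c refl → ·ᵥ-zeroʳ c }
    }

  dot : ∀ {n} → Vec Carrier n → Vec Carrier n → Carrier
  dot []       []       = 0F
  dot (x ∷ xs) (y ∷ ys) = x *F y +F dot xs ys

  dot-+· : ∀ {n} (w u v : Vec Carrier n) c → dot w (u +ᵥ c ·ᵥ v) ≡ dot w u +F c *F dot w v
  dot-+· []       []       []       c = solve 1 (λ c → :con 0 := :con 0 :+ c :* :con 0) refl c
  dot-+· (w ∷ ws) (u ∷ us) (v ∷ vs) c = trans (cong (w *F (u +F c *F v) +F_) (dot-+· ws us vs c))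
    (solve 6 (λ w u v c s t → w :* (u :+ c :* v) :+ (s :+ c :* t) := (w :* u :+ s) :+ c :* (w :* v :+ t)) refl
      w u v c (dot ws us) (dot ws vs))

  dot-zero : ∀ {n} (v : Vec Carrier n) → dot 0ᵥ v ≡ 0F
  dot-zero []       = refl
  dot-zero (x ∷ xs) = trans (cong₂ _+F_ (R.zeroˡ x) (dot-zero xs)) (R.+-identityʳ 0F)

  dot-++ : ∀ {m n} (u v : Vec Carrier m) (u′ v′ : Vec Carrier n) → dot (u Vec.++ u′) (v Vec.++ v′) ≡ dot u v +F dot u′ v′
  dot-++ []       []       u′ v′ = sym (R.+-identityˡ _)
  dot-++ (x ∷ xs) (y ∷ ys) u′ v′ = trans (cong (x *F y +F_) (dot-++ xs ys u′ v′)) (sym (R.+-assoc _ _ _))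

  +-·-cancel : ∀ {n} (u b : Vec Carrier n) c → (u +ᵥ (-F c) ·ᵥ b) +ᵥ c ·ᵥ b ≡ u
  +-·-cancel []       []       c = refl
  +-·-cancel (u ∷ us) (b ∷ bs) c = cong₂ _∷_ (begin
    u +F (-F c) *F b +F c *F b    ≡⟨ solve 4 (λ u c c′ b → u :+ c′ :* b :+ c :* b := u :+ (c′ :+ c) :* b) refl u c (-F c) b ⟩
    u +F (-F c +F c) *F b         ≡⟨ cong (λ z → u +F z *F b) (R.-‿inverseˡ c) ⟩
    u +F 0F *F b                  ≡⟨ solve 2 (λ u b → u :+ :con 0 :* b := u) refl u b ⟩
    u                             ∎) (+-·-cancel us bs c)

  module _ {n} {P : Vec Carrier (suc n) → Set} (S : IsSubspace P) where
    open IsSubspace S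

    section : Vec Carrier n → Set
    section u = P (0F ∷ u)

    section-isSubspace : IsSubspace section
    section-isSubspace = record
      { dec      = dec ∘ (0F ∷_)
      ; zero-mem = zero-mem
      ; +-mem    = λ {u} {v} p p′ → subst (λ z → P (z ∷ u +ᵥ v)) (R.+-identityʳ 0F) (+-mem p p′)
      ; ·-mem    = λ c {v} p → subst (λ z → P (z ∷ c ·ᵥ v)) (R.zeroʳ c) (·-mem c p)
      }

    module _ {b} (1∷b∈P : P (1F ∷ b)) where

      -- A step of Gaussian elimination: subtracting x times the pivot `1F ∷ b` clears the first
      -- coordinate; `unproject` adds it back.
      project : ∀ {x xs} → P (x ∷ xs) → section (xs +ᵥ (-F x) ·ᵥ b)
      project {x} {xs} p = subst (λ z → P (z ∷ xs +ᵥ (-F x) ·ᵥ b))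
        (trans (cong (x +F_) (R.*-identityʳ (-F x))) (R.-‿inverseʳ x)) (+-mem p (·-mem (-F x) 1∷b∈P))

      unproject : ∀ {x xs} → section (xs +ᵥ (-F x) ·ᵥ b) → P (x ∷ xs)
      unproject {x} {xs} p = subst P
        (cong₂ _∷_ (trans (R.+-identityˡ _) (R.*-identityʳ x)) (+-·-cancel xs b x)) (+-mem p (·-mem x 1∷b∈P))

  -- Induction on the dimension. If P has a pivot (1, b), a functional f on the section extends by
  -- the first coefficient -f(b), forced by vanishing on the pivot. Otherwise P lies in the
  -- hyperplane x = 0, as a vector outside it could be scaled to a pivot; then either v lies there
  -- too and recursion applies, or the first coordinate separates.
  separate : ∀ {n} {P : Vec Carrier n → Set} → IsSubspace P → ∀ v → ¬ P v →
             ∃ λ w → dot w v ≢ 0F × (∀ u → P u → dot w u ≡ 0F)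
  separate {zero}  S [] []∉P = contradiction (IsSubspace.zero-mem S) []∉P
  separate {suc n} {P} S (v ∷ vs) v∉P with searchVec n (λ b → IsSubspace.dec S (1F ∷ b))
  ... | yes (b , 1∷b∈P) = -F dot f b ∷ f , fv≢0 ∘ trans (sym (dot-w v vs)) , vanish
    where
    rec  = separate (section-isSubspace S) (vs +ᵥ (-F v) ·ᵥ b) (v∉P ∘ unproject S 1∷b∈P)
    f    = proj₁ rec
    fv≢0 = proj₁ (proj₂ rec)
    dot-w : ∀ x xs → dot (-F dot f b ∷ f) (x ∷ xs) ≡ dot f (xs +ᵥ (-F x) ·ᵥ b)
    dot-w x xs = begin
      (-F dot f b) *F x +F dot f xs   ≡⟨ R.+-comm _ _ ⟩
      dot f xs +F (-F dot f b) *F x   ≡⟨ cong (dot f xs +F_) (trans (sym (RP.-‿distribˡ-* _ x)) (trans (cong -F_ (R.*-comm _ x)) (RP.-‿distribˡ-* x _))) ⟩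
      dot f xs +F (-F x) *F dot f b   ≡⟨ dot-+· f xs b (-F x) ⟨
      dot f (xs +ᵥ (-F x) ·ᵥ b)       ∎
    vanish : ∀ u → P u → dot (-F dot f b ∷ f) u ≡ 0F
    vanish (x ∷ xs) p = trans (dot-w x xs) (proj₂ (proj₂ rec) _ (project S 1∷b∈P p))
  ... | no ¬1∷b∈P with v ≟ 0F
  ...   | yes refl = 0F ∷ f , fv≢0 ∘ trans (sym (dot-w 0F vs)) , vanish
    where
    rec  = separate (section-isSubspace S) vs v∉P
    f    = proj₁ rec
    fv≢0 = proj₁ (proj₂ rec)
    dot-w : ∀ x xs → dot (0F ∷ f) (x ∷ xs) ≡ dot f xs
    dot-w x xs = trans (cong (_+F dot f xs) (R.zeroˡ x)) (R.+-identityˡ _)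
    vanish : ∀ u → P u → dot (0F ∷ f) u ≡ 0F
    vanish (x ∷ xs) p with x ≟ 0F
    ... | yes refl = trans (dot-w 0F xs) (proj₂ (proj₂ rec) xs p)
    ... | no x≢0   = let y , yx≡1 = inverseˡ x≢0 in
      contradiction (y ·ᵥ xs , subst (λ z → P (z ∷ y ·ᵥ xs)) yx≡1 (IsSubspace.·-mem S y p)) ¬1∷b∈P
  ...   | no v≢0 = 1F ∷ 0ᵥ , v≢0 ∘ trans (sym (dot-w v vs)) , vanish
    where
    dot-w : ∀ x xs → dot (1F ∷ 0ᵥ) (x ∷ xs) ≡ x
    dot-w x xs = trans (cong₂ _+F_ (R.*-identityˡ x) (dot-zero xs)) (R.+-identityʳ x)
    vanish : ∀ u → P u → dot (1F ∷ 0ᵥ) u ≡ 0F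
    vanish (x ∷ xs) p with x ≟ 0F
    ... | yes refl = dot-w 0F xs
    ... | no x≢0   = let y , yx≡1 = inverseˡ x≢0 in
      contradiction (y ·ᵥ xs , subst (λ z → P (z ∷ y ·ᵥ xs)) yx≡1 (IsSubspace.·-mem S y p)) ¬1∷b∈P

  -- The right side is built from sums and scalar multiples only, so a subspace containing `a` and
  -- `b` contains it.
  combination-swap : ∀ {n} (v a b : Vec Carrier n) c d → c ·ᵥ v +ᵥ a ≡ d ·ᵥ v +ᵥ b →
                     (c R.- d) ·ᵥ v ≡ b +ᵥ (-F 1F) ·ᵥ a
  combination-swap []       []       []       c d eq = refl
  combination-swap (v ∷ vs) (a ∷ as) (b ∷ bs) c d eq with hd , tl ← Vec.∷-injective eq =
    -- After adding d v + a to both sides, negatives can be treated as independent letters; -d + d =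
    -- 0 and -1 + 1 = 0 enter as steps of their own.
    cong₂ _∷_ (RP.+-cancelʳ (d *F v +F a) _ _ (begin
      (c +F d′) *F v +F (d *F v +F a)
        ≡⟨ solve 5 (λ c d d′ v a → (c :+ d′) :* v :+ (d :* v :+ a) := (c :* v :+ a) :+ (d′ :+ d) :* v) refl c d d′ v a ⟩
      c *F v +F a +F (d′ +F d) *F v
        ≡⟨ cong₂ (λ s t → s +F t *F v) hd (R.-‿inverseˡ d) ⟩
      d *F v +F b +F 0F *F v
        ≡⟨ solve 4 (λ d v a b → d :* v :+ b :+ :con 0 :* v := b :+ :con 0 :* a :+ d :* v) refl d v a b ⟩
      b +F 0F *F a +F d *F v
        ≡⟨ cong (λ z → b +F z *F a +F d *F v) (R.-‿inverseˡ 1F) ⟨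
      b +F (-F 1F +F 1F) *F a +F d *F v
        ≡⟨ solve 5 (λ b e a d v → b :+ (e :+ :con 1) :* a :+ d :* v := (b :+ e :* a) :+ (d :* v :+ a)) refl b (-F 1F) a d v ⟩
      b +F (-F 1F) *F a +F (d *F v +F a) ∎)) (combination-swap vs as bs c d tl)
    where d′ = -F d

  extendBy : ∀ {m n} → Vec Carrier n → (Vec Carrier m → Vec Carrier n) → Vec Carrier (suc m) → Vec Carrier n
  extendBy v f (c ∷ cs) = c ·ᵥ v +ᵥ f cs

  -- Linear independence is expressed as injectivity of the combination map. Two different
  -- coefficients of `v` would put a nonzero multiple of `v`, hence `v`, into P.
  extendBy-injective : ∀ {m n} {P : Vec Carrier n → Set} → IsSubspace P → ∀ {v} → ¬ P v →
                       ∀ {f : Vec Carrier m → Vec Carrier n} → (∀ cs → P (f cs)) → (∀ {x y} → f x ≡ f y → x ≡ y) →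
                       ∀ {x y} → extendBy v f x ≡ extendBy v f y → x ≡ y
  extendBy-injective {P = P} S {v} v∉P {f} f∈P f-inj {c ∷ cs} {d ∷ ds} eq with c ≟ d
  ... | yes refl = cong (c ∷_) (f-inj (+ᵥ-cancelˡ (c ·ᵥ v) _ _ eq))
  ... | no c≢d   = contradiction
    (·-mem⁻¹ (c≢d ∘ x-y≡0⇒x≡y)
      (subst P (sym (combination-swap v (f cs) (f ds) c d eq)) (+-mem (f∈P ds) (·-mem (-F 1F) (f∈P cs))))) v∉P
    where open IsSubspace S

  vec↔ : ∀ n → Fin (q ℕ.^ n) ↔ Vec Carrier n
  vec↔ zero    = mk↔ₛ′ (λ _ → []) (λ _ → zero) (λ { [] → refl }) (λ { zero → refl })
  vec↔ (suc n) = ↔-trans Fin.*↔× (↔-trans (enumeration ×-↔ vec↔ n)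
    (mk↔ₛ′ (uncurry _∷_) Vec.uncons (λ { (x ∷ xs) → refl }) (λ { (x , xs) → refl })))

  -- Vectors with first nonzero coordinate 1: representatives of the points of projective space.
  Point : ℕ → Set
  Point zero    = ⊥
  Point (suc n) = Vec Carrier n ⊎ Point n

  toVec : ∀ {n} → Point n → Vec Carrier n
  toVec {suc n} (inj₁ xs) = 1F ∷ xs
  toVec {suc n} (inj₂ p)  = 0F ∷ toVec p

  toVec-nonzero : ∀ {n} (p : Point n) → toVec p ≢ 0ᵥ
  toVec-nonzero {suc n} (inj₁ xs) eq = 0≢1 (sym (Vec.∷-injectiveˡ eq))
  toVec-nonzero {suc n} (inj₂ p)  eq = toVec-nonzero p (Vec.∷-injectiveʳ eq)

  toPoint : ∀ {n} (v : Vec Carrier n) → v ≢ 0ᵥ → ∃₂ λ p c → toVec p ≡ c ·ᵥ v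
  toPoint []       v≢0 = contradiction refl v≢0
  toPoint (x ∷ xs) v≢0 with x ≟ 0F
  ... | no x≢0 = let y , yx≡1 = inverseˡ x≢0 in inj₁ (y ·ᵥ xs) , y , cong (_∷ y ·ᵥ xs) (sym yx≡1)
  ... | yes refl with p , c , eq ← toPoint xs (v≢0 ∘ cong (0F ∷_)) = inj₂ p , c , cong₂ _∷_ (sym (R.zeroʳ c)) eq

  -- Where both leading ones stand in the same place the factor is 1; in different places, the first
  -- vector would be 0 or 1 would equal 0.
  toVec-proportional : ∀ {n} (p p′ : Point n) c → toVec p ≡ c ·ᵥ toVec p′ → p ≡ p′
  toVec-proportional {suc n} (inj₁ xs) (inj₁ ys) c eq with hd , tl ← Vec.∷-injective eq =
    cong inj₁ (trans tl (trans (cong (_·ᵥ ys) (sym (trans hd (R.*-identityʳ c)))) (·ᵥ-identity ys)))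
  toVec-proportional {suc n} (inj₁ xs) (inj₂ p′) c eq =
    contradiction (sym (trans (Vec.∷-injectiveˡ eq) (R.zeroʳ c))) 0≢1
  toVec-proportional {suc n} (inj₂ p) (inj₁ ys) c eq with hd , tl ← Vec.∷-injective eq =
    contradiction (trans tl (trans (cong (_·ᵥ ys) (sym (trans hd (R.*-identityʳ c)))) (·ᵥ-zeroˡ ys))) (toVec-nonzero p)
  toVec-proportional {suc n} (inj₂ p) (inj₂ p′) c eq = cong inj₂ (toVec-proportional p p′ c (Vec.∷-injectiveʳ eq))

  common-multiple : ∀ {n} (p p′ : Point n) {u} → u ≢ 0ᵥ → ∀ c d → u ≡ c ·ᵥ toVec p → u ≡ d ·ᵥ toVec p′ → p ≡ p′
  common-multiple p p′ {u} u≢0 c d u≡cp u≡dp′ with c ≟ 0F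
  ... | yes refl = contradiction (trans u≡cp (·ᵥ-zeroˡ _)) u≢0
  ... | no c≢0 with e , ec≡1 ← inverseˡ c≢0 = toVec-proportional p p′ (e *F d) (begin
    toVec p                 ≡⟨ ·ᵥ-inverse ec≡1 (toVec p) ⟨
    e ·ᵥ c ·ᵥ toVec p       ≡⟨ cong (e ·ᵥ_) (trans (sym u≡cp) u≡dp′) ⟩
    e ·ᵥ d ·ᵥ toVec p′      ≡⟨ ·ᵥ-assoc e d (toVec p′) ⟨
    (e *F d) ·ᵥ toVec p′    ∎)

-- The sum q ^ (n - 1) + ... + q + 1, the number of points of the projective space of an
-- n-dimensional space.
pointCount : ℕ → ℕ → ℕ
pointCount q zero    = 0
pointCount q (suc n) = q ℕ.^ n ℕ.+ pointCount q n

point↔ : ∀ {q} (F : FiniteField q) n → Fin (pointCount q n) ↔ Vectors.Point F n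
point↔ F zero    = mk↔ₛ′ (λ ()) (λ ()) (λ ()) (λ ())
point↔ F (suc n) = ↔-trans Fin.+↔⊎ (Vectors.vec↔ F n ⊎-↔ point↔ F n)

pointCount-mono-≤ : ∀ {q q′} n → q ≤ q′ → pointCount q n ≤ pointCount q′ n
pointCount-mono-≤ zero    q≤q′ = z≤n
pointCount-mono-≤ (suc n) q≤q′ = ℕ.+-mono-≤ (ℕ.^-monoˡ-≤ n q≤q′) (pointCount-mono-≤ n q≤q′)

-- With at least two terms the leading one has a positive exponent and is strictly increasing in q;
-- with a single term the count would be 1 for every q.
pointCount-cancel-≤ : ∀ {q q′} n → pointCount q (2+ n) ≤ pointCount q′ (2+ n) → q ≤ q′
pointCount-cancel-≤ n le = ℕ.≮⇒≥ λ q′<q → ℕ.<⇒≱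
  (ℕ.+-mono-<-≤ (ℕ.^-monoˡ-< (suc n) q′<q) (pointCount-mono-≤ (suc n) (ℕ.<⇒≤ q′<q))) le

injection⇒≤ : ∀ {m n} {A B : Set} → Fin m ↔ A → Fin n ↔ B → (f : A → B) → (∀ {x y} → f x ≡ f y → x ≡ y) → m ≤ n
injection⇒≤ e e′ f f-inj = Fin.injective⇒≤ {f = Inverse.from e′ ∘ f ∘ Inverse.to e} λ eq →
  Injection.injective (↔⇒↣ e) (f-inj (Injection.injective (↔⇒↣ (↔-sym e′)) eq))

-- Subspaces of the symplectic space

does-true : ∀ {A : Set} (a? : Dec A) → does a? ≡ true → A
does-true (yes a) _ = a

module SymplecticTheory {q : ℕ} (F : FiniteField q) (ν : ℕ) where
  open FieldTheory F
  open Vectors F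
  open Symplectic F ν public
  open Solver using (solve; _:+_; _:*_; _:=_) renaming (con to :con)

  dim : ℕ
  dim = ν ℕ.+ ν

  mem : ProperSubspace → Row → Bool
  mem A = Subspace.mem (ProperSubspace.subspace A)

  infix 4 _∈_ _⊑_
  _∈_ : Row → ProperSubspace → Set
  v ∈ A = mem A v ≡ true

  _⊑_ : ProperSubspace → ProperSubspace → Set
  A ⊑ B = ∀ v → v ∈ A → v ∈ B

  ∈-isSubspace : ∀ A → IsSubspace (_∈ A)
  ∈-isSubspace A = record
    { dec      = λ v → mem A v Bool.≟ true
    ; zero-mem = Subspace.mem-0 (ProperSubspace.subspace A)
    ; +-mem    = Subspace.mem-+ (ProperSubspace.subspace A) _ _
    ; ·-mem    = λ c → Subspace.mem-· (ProperSubspace.subspace A) c _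
    }

  false⇒¬∈ : ∀ A {v} → mem A v ≡ false → ¬ v ∈ A
  false⇒¬∈ A v∉A v∈A with () ← trans (sym v∉A) v∈A

  module _ {P : Row → Set} (S : IsSubspace P) {u v : Row} (u≢0 : u ≢ zeroRow) (u∈P : P u) (v∉P : ¬ P v) where
    open IsSubspace S

    abstract
      properSubspace : ProperSubspace
      properSubspace = record
        { subspace = record
          { mem   = λ w → does (dec w)
          ; mem-0 = dec-true (dec zeroRow) zero-mem
          ; mem-+ = λ w w′ p p′ → dec-true (dec (w +R w′)) (+-mem (does-true (dec w) p) (does-true (dec w′) p′))
          ; mem-· = λ c w p → dec-true (dec (c ·R w)) (·-mem c (does-true (dec w) p))
          }
        ; nonzero = u , u≢0 , dec-true (dec u) u∈P
        ; nonfull = v , dec-false (dec v) v∉P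
        }

      ∈-properSubspace : ∀ {w} → P w → w ∈ properSubspace
      ∈-properSubspace {w} = dec-true (dec w)

      properSubspace-∈ : ∀ {w} → w ∈ properSubspace → P w
      properSubspace-∈ {w} = does-true (dec w)

  ∑-zero : ∀ n {f : Fin n → Carrier} → (∀ i → f i ≡ 0F) → ∑ n f ≡ 0F
  ∑-zero zero    f≡0 = refl
  ∑-zero (suc n) f≡0 = trans (cong₂ _+F_ (f≡0 zero) (∑-zero n (f≡0 ∘ suc))) (R.+-identityʳ 0F)

  ∑-scale : ∀ n {f g : Fin n → Carrier} c → (∀ i → f i ≡ c *F g i) → ∑ n f ≡ c *F ∑ n g
  ∑-scale zero    c eq = sym (R.zeroʳ c)
  ∑-scale (suc n) c eq = trans (cong₂ _+F_ (eq zero) (∑-scale n c (eq ∘ suc))) (sym (R.distribˡ c _ _))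

  ∑-dot : ∀ n (w₁ w₂ a b : Vec Carrier n) {f : Fin n → Carrier} →
          (∀ i → f i ≡ lookup w₁ i *F lookup a i +F lookup w₂ i *F lookup b i) → ∑ n f ≡ dot w₁ a +F dot w₂ b
  ∑-dot zero    []       []       []       []       eq = sym (R.+-identityʳ 0F)
  ∑-dot (suc n) (x ∷ w₁) (y ∷ w₂) (a ∷ as) (b ∷ bs) eq =
    trans (cong₂ _+F_ (eq zero) (∑-dot n w₁ w₂ as bs (eq ∘ suc)))
      (solve 4 (λ s t u v → (s :+ t) :+ (u :+ v) := (s :+ u) :+ (t :+ v)) refl
        (x *F a) (y *F b) (dot w₁ as) (dot w₂ bs))

  private
    scale-difference : ∀ c x y x′ y′ → x′ ≡ c *F x → y′ ≡ c *F y → x′ R.- y′ ≡ c *F (x R.- y)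
    scale-difference c x y _ _ refl refl = sym (RP.x[y-z]≈xy-xz c x y)

  form-scaleʳ : ∀ c α β → ⟪ α , c ·R β ⟫ ≡ c *F ⟪ α , β ⟫
  form-scaleʳ c α β = ∑-scale ν c λ i → scale-difference c _ _ _ _ (term _ _) (term _ _)
    where
    term : ∀ i j → lookup α i *F lookup (c ·R β) j ≡ c *F (lookup α i *F lookup β j)
    term i j = trans (cong (lookup α i *F_) (Vec.lookup-map j (c *F_) β))
      (solve 3 (λ a c b → a :* (c :* b) := c :* (a :* b)) refl (lookup α i) c (lookup β j))

  form-alternating : ∀ α → ⟪ α , α ⟫ ≡ 0F
  form-alternating α = ∑-zero ν λ i → RP.x≈y⇒x∙y⁻¹≈ε (R.*-comm _ _)

  -- Nondegeneracy of the form: pairing (a, b) with (-w₂, w₁) gives a · w₁ + b · w₂.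
  functional : ∀ w → ∃ λ w′ → ∀ v → ⟪ v , w′ ⟫ ≡ dot w v
  functional w with w₁ , w₂ , refl ← Vec.splitAt ν w = w′ , λ v → represents v (Vec.splitAt ν v)
    where
    w′ = map -F_ w₂ Vec.++ w₁
    represents : ∀ v → (∃₂ λ a b → v ≡ a Vec.++ b) → ⟪ v , w′ ⟫ ≡ dot (w₁ Vec.++ w₂) v
    represents _ (a , b , refl) = trans (∑-dot ν w₁ w₂ a b term) (sym (dot-++ w₁ a w₂ b))
      where
      term : ∀ i → (lookup (a Vec.++ b) (i Fin.↑ˡ ν) *F lookup w′ (ν Fin.↑ʳ i)) +F
                   -F (lookup (a Vec.++ b) (ν Fin.↑ʳ i) *F lookup w′ (i Fin.↑ˡ ν)) ≡
                   lookup w₁ i *F lookup a i +F lookup w₂ i *F lookup b i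
      term i = cong₂ _+F_
        (trans (cong₂ _*F_ (Vec.lookup-++ˡ a b i) (Vec.lookup-++ʳ (map -F_ w₂) w₁ i)) (R.*-comm _ _))
        (begin
          -F (lookup (a Vec.++ b) (ν Fin.↑ʳ i) *F lookup w′ (i Fin.↑ˡ ν))
            ≡⟨ cong₂ (λ s t → -F (s *F t)) (Vec.lookup-++ʳ a b i)
                 (trans (Vec.lookup-++ˡ (map -F_ w₂) w₁ i) (Vec.lookup-map i -F_ w₂)) ⟩
          -F (lookup b i *F -F lookup w₂ i)    ≡⟨ RP.-‿distribʳ-* _ _ ⟩
          lookup b i *F -F (-F lookup w₂ i)    ≡⟨ cong (lookup b i *F_) (RP.-‿involutive _) ⟩
          lookup b i *F lookup w₂ i            ≡⟨ R.*-comm _ _ ⟩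
          lookup w₂ i *F lookup b i            ∎)

  separateForm : ∀ {P : Row → Set} → IsSubspace P → ∀ v → ¬ P v →
                 ∃ λ w → ⟪ v , w ⟫ ≢ 0F × (∀ u → P u → ⟪ u , w ⟫ ≡ 0F)
  separateForm S v v∉P with w , wv≢0 , w⊥P ← separate S v v∉P with w′ , w′≡ ← functional w =
    w′ , wv≢0 ∘ trans (sym (w′≡ v)) , λ u u∈P → trans (w′≡ u) (w⊥P u u∈P)

  Multiple : Row → Row → Set
  Multiple x v = ∃ λ c → v ≡ c ·R x

  multiple-isSubspace : ∀ x → IsSubspace (Multiple x)
  multiple-isSubspace x = record
    { dec      = λ v → search λ c → v ≟ᵥ c ·R x
    ; zero-mem = 0F , sym (·ᵥ-zeroˡ x)
    ; +-mem    = λ { (c , refl) (d , refl) → c +F d , distrib c d x }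
    ; ·-mem    = λ { c (d , refl) → c *F d , sym (·ᵥ-assoc c d x) }
    }
    where
    distrib : ∀ {n} c d (x : Vec Carrier n) → c ·ᵥ x +ᵥ d ·ᵥ x ≡ (c +F d) ·ᵥ x
    distrib c d []       = refl
    distrib c d (x ∷ xs) = cong₂ _∷_ (sym (R.distribʳ x c d)) (distrib c d xs)

  self-multiple : ∀ x → Multiple x x
  self-multiple x = 1F , sym (·ᵥ-identity x)

  module _ {x : Row} (x≢0 : x ≢ zeroRow) where
    private
      sep = separateForm isSubspace-0 x x≢0

      -- The form is alternating, so `x` is orthogonal to its multiples; a vector not orthogonal to
      -- `x` shows that the line is not the whole space.
      partner∉ : ¬ Multiple x (proj₁ sep)
      partner∉ (c , eq) = proj₁ (proj₂ sep) (begin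
        ⟪ x , proj₁ sep ⟫  ≡⟨ cong ⟪ x ,_⟫ eq ⟩
        ⟪ x , c ·R x ⟫     ≡⟨ form-scaleʳ c x x ⟩
        c *F ⟪ x , x ⟫     ≡⟨ cong (c *F_) (form-alternating x) ⟩
        c *F 0F            ≡⟨ R.zeroʳ c ⟩
        0F                 ∎)

    line : ProperSubspace
    line = properSubspace (multiple-isSubspace x) x≢0 (self-multiple x) partner∉

    ∈-line : ∀ {v} → Multiple x v → v ∈ line
    ∈-line = ∈-properSubspace (multiple-isSubspace x) x≢0 (self-multiple x) partner∉

    line-∈ : ∀ {v} → v ∈ line → Multiple x v
    line-∈ = properSubspace-∈ (multiple-isSubspace x) x≢0 (self-multiple x) partner∉

    line-⊑ : ∀ A → x ∈ A → line ⊑ A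
    line-⊑ A x∈A v v∈ with c , refl ← line-∈ v∈ = IsSubspace.·-mem (∈-isSubspace A) c x∈A

  adjacent-antitone : ∀ {A B} → A ⊑ B → ∀ C → Adjacent B C → Adjacent A C
  adjacent-antitone A⊑B C B~C α β α∈A β∈C = B~C α β (A⊑B α α∈A) β∈C

  -- Inclusion is visible in the graph, because a subspace is its own double perp.
  adjacent⇒⊑ : ∀ {A B} → (∀ C → Adjacent B C → Adjacent A C) → A ⊑ B
  adjacent⇒⊑ {A} {B} A≤B v v∈A = decidable-stable (mem B v Bool.≟ true) λ v∉B →
    let w , vw≢0 , w⊥B = separateForm (∈-isSubspace B) v v∉B
        w≢0 = λ w≡0 → vw≢0 (trans (cong ⟪ v ,_⟫ (trans w≡0 (sym (·ᵥ-zeroˡ w)))) (trans (form-scaleʳ 0F v w) (R.zeroˡ _)))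
        B~w : Adjacent B (line w≢0)
        B~w = λ α β α∈B β∈w → let c , eq = line-∈ w≢0 β∈w in
          trans (cong ⟪ α ,_⟫ eq) (trans (form-scaleʳ c α w) (trans (cong (c *F_) (w⊥B α α∈B)) (R.zeroʳ c)))
    in vw≢0 (A≤B (line w≢0) B~w v w v∈A (∈-line w≢0 (self-multiple w)))

  adjacent-resp : ∀ {A A′ B B′} → A ≈S A′ → B ≈S B′ → Adjacent A B → Adjacent A′ B′
  adjacent-resp A≈A′ B≈B′ A~B α β α∈A′ β∈B′ = A~B α β (trans (A≈A′ α) α∈A′) (trans (B≈B′ β) β∈B′)

  -- Chains of subspaces and the standard flag.

  ¬⊑⇒witness : ∀ {A B} → ¬ A ⊑ B → ∃ λ v → v ∈ A × ¬ v ∈ B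
  ¬⊑⇒witness {A} {B} A⋢B with searchVec dim (λ v → (mem A v Bool.≟ true) ×-dec ¬? (mem B v Bool.≟ true))
  ... | yes found = found
  ... | no ¬found = contradiction
    (λ v v∈A → decidable-stable (mem B v Bool.≟ true) λ v∉B → ¬found (v , v∈A , v∉B)) A⋢B

  -- The index counts strict inclusions, so a `Chain m` has m + 1 members; the subspace in the type
  -- is the largest.
  data Chain : ℕ → ProperSubspace → Set where
    start  : ∀ A → Chain 0 A
    extend : ∀ {m A B} → Chain m A → A ⊑ B → ¬ B ⊑ A → Chain (suc m) B

  -- A nonzero vector of the first member and, at each inclusion, a vector outside the smaller
  -- member are m + 1 independent vectors.
  chain-embedding : ∀ {m A} → Chain m A → ∃ λ (f : Vec Carrier (suc m) → Row) →
                    (∀ cs → f cs ∈ A) × (∀ {x y} → f x ≡ f y → x ≡ y)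
  chain-embedding (start A) with v , v≢0 , v∈A ← ProperSubspace.nonzero A =
    extendBy v (λ _ → zeroRow) ,
    (λ { (c ∷ cs) → IsSubspace.+-mem S (IsSubspace.·-mem S c v∈A) (IsSubspace.zero-mem S) }) ,
    extendBy-injective isSubspace-0 v≢0 (λ _ → refl) (λ { {[]} {[]} _ → refl })
    where S = ∈-isSubspace A
  chain-embedding (extend {A = A} {B} chain A⊑B B⋢A)
    with f , f∈A , f-inj ← chain-embedding chain | v , v∈B , v∉A ← ¬⊑⇒witness {B} {A} B⋢A =
    extendBy v f ,
    (λ { (c ∷ cs) → IsSubspace.+-mem S (IsSubspace.·-mem S c v∈B) (A⊑B _ (f∈A cs)) }) ,
    extendBy-injective (∈-isSubspace A) v∉A f∈A f-inj
    where S = ∈-isSubspace B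

  -- A vector outside the top member extends the embedding to m + 2 coefficients, and then q ^ (m +
  -- 2) ≤ q ^ `dim`.
  chain-length : ∀ {m A} → Chain m A → 2+ m ≤ dim
  chain-length {m} {A} chain with f , f∈A , f-inj ← chain-embedding chain | v , v∉A ← ProperSubspace.nonfull A =
    ℕ.≮⇒≥ λ dim<2+m → ℕ.<⇒≱ (ℕ.^-monoʳ-< q 1<q dim<2+m)
      (injection⇒≤ (vec↔ (2+ m)) (vec↔ dim) (extendBy v f) (extendBy-injective (∈-isSubspace A) (false⇒¬∈ A v∉A) f∈A f-inj))
    where
    1<q : 1 < q
    1<q with r , refl ← size≥2 = s≤s (s≤s z≤n)

  -- Membership in the span of the first `k` unit vectors.
  record Supported (k : ℕ) (v : Row) : Set where
    constructor supported
    field vanish : ∀ j → k ≤ Fin.toℕ j → lookup v j ≡ 0F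
  open Supported

  supported-isSubspace : ∀ k → IsSubspace (Supported k)
  supported-isSubspace k = record
    { dec      = λ v → map′ supported vanish (Fin.all? λ j → (k ℕ.≤? Fin.toℕ j) →-dec (lookup v j ≟ 0F))
    ; zero-mem = supported λ j _ → Vec.lookup-replicate j 0F
    ; +-mem    = λ {u} {v} p p′ → supported λ j k≤j → trans (Vec.lookup-zipWith _+F_ j u v)
                   (trans (cong₂ _+F_ (vanish p j k≤j) (vanish p′ j k≤j)) (R.+-identityʳ 0F))
    ; ·-mem    = λ c {v} p → supported λ j k≤j → trans (Vec.lookup-map j (c *F_) v) (trans (cong (c *F_) (vanish p j k≤j)) (R.zeroʳ c))
    }

  unit : ∀ {k} → k < dim → Row
  unit k<n = zeroRow Vec.[ Fin.fromℕ< k<n ]≔ 1F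

  unit-1 : ∀ {k} (k<n : k < dim) → lookup (unit k<n) (Fin.fromℕ< k<n) ≡ 1F
  unit-1 k<n = Vec.lookup∘update (Fin.fromℕ< k<n) zeroRow 1F

  unit-supported : ∀ {k} (k<n : k < dim) → Supported (suc k) (unit k<n)
  unit-supported k<n = supported λ j k<j → trans
    (Vec.lookup∘update′ (λ { refl → ℕ.<⇒≢ k<j (sym (Fin.toℕ-fromℕ< k<n)) }) zeroRow 1F)
    (Vec.lookup-replicate j 0F)

  unit-unsupported : ∀ {k} (k<n : k < dim) → ¬ Supported k (unit k<n)
  unit-unsupported k<n supp = 0≢1 (trans
    (sym (vanish supp (Fin.fromℕ< k<n) (ℕ.≤-reflexive (sym (Fin.toℕ-fromℕ< k<n))))) (unit-1 k<n))

  unit-nonzero : ∀ {k} (k<n : k < dim) → unit k<n ≢ zeroRow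
  unit-nonzero k<n eq = unit-unsupported k<n (subst (Supported _) (sym eq) (IsSubspace.zero-mem (supported-isSubspace _)))

  module _ {k : ℕ} (1+k<n : suc k < dim) where
    private
      k<n : k < dim
      k<n = ℕ.<-trans (ℕ.n<1+n k) 1+k<n

    -- The span of the first k + 1 unit vectors: unit vector `k` shows that it is nonzero, unit
    -- vector `suc k` that it is not everything.
    coordinates : ProperSubspace
    coordinates = properSubspace (supported-isSubspace (suc k)) (unit-nonzero k<n) (unit-supported k<n) (unit-unsupported 1+k<n)

    ∈-coordinates : ∀ {v} → Supported (suc k) v → v ∈ coordinates
    ∈-coordinates = ∈-properSubspace (supported-isSubspace (suc k)) (unit-nonzero k<n) (unit-supported k<n) (unit-unsupported 1+k<n)

    coordinates-∈ : ∀ {v} → v ∈ coordinates → Supported (suc k) v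
    coordinates-∈ = properSubspace-∈ (supported-isSubspace (suc k)) (unit-nonzero k<n) (unit-supported k<n) (unit-unsupported 1+k<n)

  -- The hypothesis is k + 2 ≤ `dim`, so the bound of `chain-length` is attained.
  coordinateChain : ∀ k (1+k<n : suc k < dim) → Chain k (coordinates 1+k<n)
  coordinateChain zero    1<n   = start _
  coordinateChain (suc k) 2+k<n = extend (coordinateChain k 1+k<n)
    (λ v v∈ → ∈-coordinates 2+k<n (supported λ j 2+k≤j → vanish (coordinates-∈ 1+k<n v∈) j (ℕ.<⇒≤ 2+k≤j)))
    (λ sub → unit-unsupported 1+k<n (coordinates-∈ 1+k<n (sub _ (∈-coordinates 2+k<n (unit-supported 1+k<n)))))
    where
    1+k<n : suc k < dim
    1+k<n = ℕ.<-trans (ℕ.n<1+n (suc k)) 2+k<n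

-- Consequences of a graph isomorphism: inclusions, chains and numbers of points.

module _ {q₁ q₂ : ℕ} (F₁ : FiniteField q₁) (F₂ : FiniteField q₂) (ν₁ ν₂ : ℕ) where
  private
    module S₁ = SymplecticTheory F₁ ν₁
    module S₂ = SymplecticTheory F₂ ν₂
    module V₁ = Vectors F₁
    module V₂ = Vectors F₂

  spi-sym : Spi F₁ ν₁ ≅G Spi F₂ ν₂ → Spi F₂ ν₂ ≅G Spi F₁ ν₁
  spi-sym iso = record
    { to        = from
    ; from      = to
    ; to-cong   = from-cong
    ; from-cong = to-cong
    ; from∘to   = to∘from
    ; to∘from   = from∘to
    ; adj-to    = λ x y x~y → adj-from (from x) (from y) (S₂.adjacent-resp {x} {to (from x)} {y} {to (from y)}
                    (λ v → sym (to∘from x v)) (λ v → sym (to∘from y v)) x~y)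
    ; adj-from  = λ x y x~y → S₂.adjacent-resp {to (from x)} {x} {to (from y)} {y}
                    (to∘from x) (to∘from y) (adj-to (from x) (from y) x~y)
    }
    where open _≅G_ iso

  module _ (iso : Spi F₁ ν₁ ≅G Spi F₂ ν₂) where
    open _≅G_ iso

    -- Every neighbour C of `to B` is `to (from C)` up to equality of subspaces, so the
    -- neighbourhood criterion for inclusion can be checked in the first graph.
    to-mono : ∀ {A B} → A S₁.⊑ B → to A S₂.⊑ to B
    to-mono {A} {B} A⊑B = S₂.adjacent⇒⊑ {to A} {to B} λ C B~C →
      S₂.adjacent-resp {to A} {to A} {to (from C)} {C} (λ _ → refl) (to∘from C)
        (adj-to A (from C) (S₁.adjacent-antitone {A} {B} A⊑B (from C) (adj-from B (from C)
          (S₂.adjacent-resp {to B} {to B} {C} {to (from C)} (λ _ → refl) (λ v → sym (to∘from C v)) B~C))))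

    to-reflects : ∀ {A B} → to A S₂.⊑ to B → A S₁.⊑ B
    to-reflects {A} {B} tA⊑tB = S₁.adjacent⇒⊑ {A} {B} λ C B~C →
      adj-from A C (S₂.adjacent-antitone {to A} {to B} tA⊑tB (to C) (adj-to B C B~C))

    to-chain : ∀ {m A} → S₁.Chain m A → S₂.Chain m (to A)
    to-chain (S₁.start A)                             = S₂.start (to A)
    to-chain (S₁.extend {A = A} {B} chain A⊑B B⋢A) =
      S₂.extend (to-chain chain) (to-mono {A} {B} A⊑B) (B⋢A ∘ to-reflects {B} {A})

    -- A longest chain of the first space is carried to a chain of the second and has to obey the
    -- length bound there.
    rank-≤ : ν₁ ≤ ν₂
    rank-≤ = ℕ.≮⇒≥ λ ν₂<ν₁ → ℕ.<⇒≱ (ℕ.+-mono-< ν₂<ν₁ ν₂<ν₁) (dim-≤ (S₁.dim) ℕ.≤-refl (two≤ ν₂<ν₁))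
      where
      -- The dimension 2ν₁ is generalised to n in order to be matched as `2+ m`, with m the number
      -- of inclusions in the chain. It is at least 2 because ν₂ < ν₁.
      dim-≤ : ∀ n → n ≤ S₁.dim → 2 ≤ n → n ≤ S₂.dim
      dim-≤ (2+ m) n≤dim _ = S₂.chain-length (to-chain (S₁.coordinateChain m n≤dim))
      dim-≤ 1 _ (s≤s ())
      two≤ : ∀ {μ ν} → μ < ν → 2 ≤ ν ℕ.+ ν
      two≤ μ<ν = ℕ.+-mono-≤ (ℕ.≤-trans (s≤s z≤n) μ<ν) (ℕ.≤-trans (s≤s z≤n) μ<ν)

    private
      lineAt : V₁.Point S₁.dim → S₁.ProperSubspace
      lineAt p = S₁.line (V₁.toVec-nonzero p)

      abstract
        pointIn : ∀ A → ∃ λ p → V₂.toVec p S₂.∈ A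
        pointIn A with v , v≢0 , v∈A ← S₂.ProperSubspace.nonzero A with p , c , eq ← V₂.toPoint v v≢0 =
          p , subst (S₂._∈ A) (sym eq) (V₂.IsSubspace.·-mem (S₂.∈-isSubspace A) c v∈A)

      -- A point goes to some point chosen inside the image of its line; injectivity of this choice
      -- is enough to compare the counts.
      image : V₁.Point S₁.dim → V₂.Point S₂.dim
      image p = proj₁ (pointIn (to (lineAt p)))

      preimage : V₂.Point S₂.dim → S₁.ProperSubspace
      preimage p′ = from (S₂.line (V₂.toVec-nonzero p′))

      -- The chosen point lies in `to (lineAt p)`, hence so does its line, and `to` reflects
      -- inclusions.
      preimage-⊑ : ∀ p p′ → image p ≡ p′ → preimage p′ S₁.⊑ lineAt p
      preimage-⊑ p p′ refl = to-reflects {preimage p′} {lineAt p} λ v v∈ →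
        S₂.line-⊑ (V₂.toVec-nonzero p′) (to (lineAt p)) (proj₂ (pointIn (to (lineAt p)))) v
          (trans (sym (to∘from (S₂.line (V₂.toVec-nonzero p′)) v)) v∈)

      -- Lines with a common image share the nonzero vectors of its preimage.
      image-injective : ∀ p p′ → image p ≡ image p′ → p ≡ p′
      image-injective p p′ eq =
        let u , u≢0 , u∈ = S₁.ProperSubspace.nonzero (preimage (image p′))
            c , u≡cx     = S₁.line-∈ (V₁.toVec-nonzero p) (preimage-⊑ p (image p′) eq u u∈)
            d , u≡dx′    = S₁.line-∈ (V₁.toVec-nonzero p′) (preimage-⊑ p′ (image p′) refl u u∈)
        in V₁.common-multiple p p′ u≢0 c d u≡cx u≡dx′

    pointCount-≤ : pointCount q₁ S₁.dim ≤ pointCount q₂ S₂.dim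
    pointCount-≤ = injection⇒≤ (point↔ F₁ S₁.dim) (point↔ F₂ S₂.dim) image (image-injective _ _)

spi-rank : ∀ {q₁ q₂} (F₁ : FiniteField q₁) (F₂ : FiniteField q₂) ν₁ ν₂ → Spi F₁ ν₁ ≅G Spi F₂ ν₂ → ν₁ ≡ ν₂
spi-rank F₁ F₂ ν₁ ν₂ iso = ℕ.≤-antisym (rank-≤ F₁ F₂ ν₁ ν₂ iso) (rank-≤ F₂ F₁ ν₂ ν₁ (spi-sym F₁ F₂ ν₁ ν₂ iso))

spi-order-≤ : ∀ {q₁ q₂} (F₁ : FiniteField q₁) (F₂ : FiniteField q₂) ν → ν ≥ 1 → Spi F₁ ν ≅G Spi F₂ ν → q₁ ≤ q₂
-- For ν = μ + 1 the dimension is 2 + (μ + μ), which provides the two terms needed for cancellation.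
spi-order-≤ {q₁} {q₂} F₁ F₂ ν@(suc μ) _ iso = pointCount-cancel-≤ (μ ℕ.+ μ)
  (subst (λ n → pointCount q₁ (suc n) ≤ pointCount q₂ (suc n)) (ℕ.+-suc μ μ) (pointCount-≤ F₁ F₂ ν ν iso))

theorem2p2 : (q₁ q₂ ν₁ ν₂ : ℕ) → IsPrimePower q₁ → IsPrimePower q₂
    → ν₁ ≥ 1 → ν₂ ≥ 1
    → (F₁ : FiniteField q₁) → (F₂ : FiniteField q₂)
    → (Spi F₁ ν₁ ≅G Spi F₂ ν₂) ⇔ (ν₁ ≡ ν₂ × q₁ ≡ q₂)
theorem2p2 q₁ q₂ ν₁ ν₂ primePower _ ν₁≥1 _ F₁ F₂ = mk⇔ forward backward
  where
  forward : Spi F₁ ν₁ ≅G Spi F₂ ν₂ → ν₁ ≡ ν₂ × q₁ ≡ q₂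
  -- The ranks are identified first, since point counts determine q only in a common dimension.
  forward iso with refl ← spi-rank F₁ F₂ ν₁ ν₂ iso =
    refl , ℕ.≤-antisym (spi-order-≤ F₁ F₂ ν₁ ν₁≥1 iso) (spi-order-≤ F₂ F₁ ν₁ ν₁≥1 (spi-sym F₁ F₂ ν₁ ν₁ iso))

  backward : ν₁ ≡ ν₂ × q₁ ≡ q₂ → Spi F₁ ν₁ ≅G Spi F₂ ν₂
  backward (refl , refl) = spiIso {F₁ = F₁} {F₂} (finiteField-unique primePower F₁ F₂) ν₁
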